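{- Let $n\ge1$ be an integer. The outer measure $\boldsymbol{\kappa}:\mathcal{P}(\mathbb{R}^n)\to[0,1]$ given by $\boldsymbol{\kappa}(E)=2^{ -\mathrm{K}(E)}$ is not globally optimal.
   Context: Here $\mathbb{N}=\{0,1,2,\ldots\}$. Fix a universal prefix Turing machine $U$ (the domain of a prefix machine is a prefix-free set of binary strings; universality gives, for each prefix machine $M$, a constant $c_M$ such that whenever $M(\pi)=w$ there is $\pi'$ with $U(\pi')=w$ and $|\pi'|\le|\pi|+c_M$). The prefix Kolmogorov complexity is $\mathrm{K}(w)=\min\{|\pi|\mid U(\pi)=w\}$, extended from binary strings to countable domains such as $\mathbb{Q}^n$ by fixed standard binary encodings. For $E\subseteq\mathbb{R}^n$, $\mathrm{K}(E)=\min\{\mathrm{K}(q)\mid q\in E\cap\mathbb{Q}^n\}$, with $\min\emptyset=\infty$, and $2^{ -\infty}=0$. The function $\boldsymbol\kappa$ is an outer measure on $\mathbb{R}^n$. An outer measure on $\mathbb{R}^n$ is a function $\mu:\mathcal{P}(\mathbb{R}^n)\to[0,\infty]$ with $\mu(\emptyset)=0$ that is monotone and countably subadditive. It is *supported on $\mathbb{Q}^n$* if $\mu(\mathbb{R}^n\setminus\mathbb{Q}^n)=0$. It is *finitely supported on $\mathbb{Q}^n$* if for every $\varepsilon>0$ there is a finite set $A\subseteq\mathbb{Q}^n$ with $\mu(\mathbb{R}^n\setminus A)<\varepsilon$. It is *strongly finite* if it is supported on $\mathbb{Q}^n$ and $\sum_{q\in\mathbb{Q}^n}\mu(\{q\})<\infty$.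 It is *lower semicomputable* if it is finitely supported on $\mathbb{Q}^n$ and there is a computable function $\hat\mu:\mathcal{P}^{<\omega}(\mathbb{Q}^n)\times\mathbb{N}\to\mathbb{Q}\cap[0,\infty)$ (where $\mathcal{P}^{<\omega}(\mathbb{Q}^n)$ is the set of all finite subsets of $\mathbb{Q}^n$) such that for all finite $A\subseteq\mathbb{Q}^n$: (i) $\hat\mu(A,s)\le\hat\mu(A,t)\le\mu(A)$ whenever $s\le t$; (ii) $\lim_{t\to\infty}\hat\mu(A,t)=\mu(A)$. An outer measure $\mu$ on $\mathbb{R}^n$ is *globally optimal* if (i) $\mu$ is strongly finite and lower semicomputable, and (ii) for every strongly finite, lower semicomputable outer measure $\nu$ on $\mathbb{R}^n$ there is a constant $\beta\in(0,\infty)$ such that $\mu(E)\ge\beta\cdot\nu(E)$ for all $E\subseteq\mathbb{R}^n$. -}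

module Defs where

open import Axiom.ExcludedMiddle using (ExcludedMiddle)
open import Data.Bool using (Bool; true; false)
open import Data.Empty using (⊥; ⊥-elim)
open import Data.Fin using (Fin; zero; suc)
open import Data.Integer using (ℤ; +_; -[1+_])
open import Data.List using (List; []; _∷_; foldr; map; length; upTo)
open import Data.List.Membership.Propositional.Properties using (∈-upTo⁺)
open import Data.List.Relation.Binary.BagAndSetEquality using (_∼[_]_; set)
open import Data.List.Relation.Binary.Prefix.Heterogeneous using (Prefix)
open import Data.List.Relation.Unary.Any as Any using (Any)
open import Data.List.Relation.Unary.Unique.Propositional using (Unique)
open import Data.Maybe using (Maybe; just; nothing)
open import Data.Nat as ℕ using (ℕ; zero; suc)
import Data.Nat.Induction as ℕ
import Data.Nat.Properties as ℕ
open import Data.Nat.Binary using (ℕᵇ; 2[1+_]; 1+[2_]; fromℕ)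
open import Data.Product using (Σ; ∃; ∃-syntax; _×_; _,_)
open import Data.Rational as ℚ using (ℚ; 0ℚ; 1ℚ; ½; NonNegative)
import Data.Rational.Properties as ℚ
open import Data.Sum using (_⊎_; inj₁; inj₂)
open import Data.Unit using (⊤; tt)
open import Data.Vec as Vec using (Vec; []; _∷_)
open import Data.Vec.Functional using (Vector)
open import Data.Vec.Functional.Relation.Binary.Pointwise using (Pointwise)
open import Function using (_⇔_; mk⇔; Equivalence; _∘_; id)
open import Level using (0ℓ)
open import Relation.Binary using (_Respects_; tri<; tri≈; tri>)
open import Relation.Binary.PropositionalEquality using (_≡_; refl; sym; trans; cong; subst)
open import Relation.Nullary using (¬_; yes; no)
open import Relation.Nullary.Decidable using (toWitness)
open import Relation.Nullary.Construct.Add.Supremum using (_⁺; ⊤⁺; [_])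

-- An element x is represented by its open lower cut { q ∈ ℚ ∣ q < x }.
record [0,∞] : Set₁ where
  field
    Below    : ℚ → Set
    negative : ∀ {q} → q ℚ.< 0ℚ → Below q
    downward : ∀ {p q} → p ℚ.< q → Below q → Below p
    rounded  : ∀ {q} → Below q → ∃[ r ] (q ℚ.< r × Below r)

open [0,∞] public

infix 4 _≤_ _<_ _≈_

_≤_ : [0,∞] → [0,∞] → Set
x ≤ y = ∀ q → Below x q → Below y q

_<_ : [0,∞] → [0,∞] → Set
x < y = ∃[ q ] (¬ Below x q × Below y q)

_≈_ : [0,∞] → [0,∞] → Set
x ≈ y = x ≤ y × y ≤ x

fromℚ : (r : ℚ) → .{{NonNegative r}} → [0,∞]
fromℚ r = record
  { Below    = λ q → q ℚ.< r
  ; negative = λ q<0 → ℚ.<-≤-trans q<0 (ℚ.nonNegative⁻¹ r)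
  ; downward = ℚ.<-trans
  ; rounded  = ℚ.<-dense
  }

0∞ : [0,∞]
0∞ = fromℚ 0ℚ

∞ : [0,∞]
∞ = record
  { Below    = λ _ → ⊤
  ; negative = λ _ → tt
  ; downward = λ _ _ → tt
  ; rounded  = λ {q} _ → q ℚ.+ 1ℚ
             , subst (ℚ._< q ℚ.+ 1ℚ) (ℚ.+-identityʳ q)
                 (ℚ.+-monoʳ-< q (ℚ.positive⁻¹ 1ℚ))
             , tt
  }

_∈⟨0,∞⟩ : [0,∞] → Set
x ∈⟨0,∞⟩ = 0∞ < x × x < ∞

infixl 6 _+_
infixl 7 _*_

private
  shrink : ∀ {q r} → q ℚ.< r → ∃[ b ] (b ℚ.< 0ℚ × q ℚ.< r ℚ.+ b)
  shrink {q} {r} q<r =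
    let b , q-r<b , b<0 = ℚ.<-dense q-r<0
    in b , b<0 , subst (ℚ._< r ℚ.+ b) r+[q-r] (ℚ.+-monoʳ-< r q-r<b)
    where
    q-r<0 : q ℚ.- r ℚ.< 0ℚ
    q-r<0 = subst (q ℚ.- r ℚ.<_) (ℚ.+-inverseʳ r) (ℚ.+-monoˡ-< (ℚ.- r) q<r)

    r+[q-r] : r ℚ.+ (q ℚ.- r) ≡ q
    r+[q-r] = trans (ℚ.+-comm r (q ℚ.- r))
             (trans (ℚ.+-assoc q (ℚ.- r) r)
             (trans (cong (q ℚ.+_) (ℚ.+-inverseˡ r)) (ℚ.+-identityʳ q)))

_+_ : [0,∞] → [0,∞] → [0,∞]
x + y = record
  { Below    = λ q → ∃[ a ] ∃[ b ] (Below x a × Below y b × q ℚ.< a ℚ.+ b)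
  ; negative = λ q<0 →
      let a , q<a , a<0 = ℚ.<-dense q<0
          b , b<0 , q<a+b = shrink q<a
      in a , b , negative x a<0 , negative y b<0 , q<a+b
  ; downward = λ p<q (a , b , a<x , b<y , q<a+b) →
      a , b , a<x , b<y , ℚ.<-trans p<q q<a+b
  ; rounded  = λ (a , b , a<x , b<y , q<a+b) →
      let r , q<r , r<a+b = ℚ.<-dense q<a+b
      in r , q<r , a , b , a<x , b<y , r<a+b
  }

-- With the convention 0 · ∞ = 0.
_*_ : [0,∞] → [0,∞] → [0,∞]
x * y = record
  { Below    = λ q → q ℚ.< 0ℚ ⊎
      ∃[ a ] ∃[ b ] (0ℚ ℚ.≤ a × 0ℚ ℚ.≤ b × Below x a × Below y b × q ℚ.< a ℚ.* b)
  ; negative = inj₁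
  ; downward = λ where
      p<q (inj₁ q<0) → inj₁ (ℚ.<-trans p<q q<0)
      p<q (inj₂ (a , b , 0≤a , 0≤b , a<x , b<y , q<ab)) →
        inj₂ (a , b , 0≤a , 0≤b , a<x , b<y , ℚ.<-trans p<q q<ab)
  ; rounded  = λ where
      (inj₁ q<0) → let r , q<r , r<0 = ℚ.<-dense q<0 in r , q<r , inj₁ r<0
      (inj₂ (a , b , 0≤a , 0≤b , a<x , b<y , q<ab)) →
        let r , q<r , r<ab = ℚ.<-dense q<ab
        in r , q<r , inj₂ (a , b , 0≤a , 0≤b , a<x , b<y , r<ab)
  }

⨆ : {I : Set} → (I → [0,∞]) → [0,∞]
⨆ x = record
  { Below    = λ q → q ℚ.< 0ℚ ⊎ ∃[ i ] Below (x i) q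
  ; negative = inj₁
  ; downward = λ where
      p<q (inj₁ q<0)    → inj₁ (ℚ.<-trans p<q q<0)
      p<q (inj₂ (i , h)) → inj₂ (i , downward (x i) p<q h)
  ; rounded  = λ where
      (inj₁ q<0)    → let r , q<r , r<0 = ℚ.<-dense q<0 in r , q<r , inj₁ r<0
      (inj₂ (i , h)) → let r , q<r , h' = rounded (x i) h in r , q<r , inj₂ (i , h')
  }

sum : List [0,∞] → [0,∞]
sum = foldr _+_ 0∞

-- Unordered sum over all elements of a type: the supremum of the sums
-- over its finite subsets, given as duplicate-free lists.
∑ : {I : Set} → (I → [0,∞]) → [0,∞]
∑ {I} x = ⨆ {Σ (List I) Unique} λ (is , _) → sum (map x is)

∑ℕ : (ℕ → [0,∞]) → [0,∞]
∑ℕ x = ⨆ λ N → sum (map x (upTo N))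

private
  term≤sum : ∀ {I : Set} (x : I → [0,∞]) {i is} → Any (i ≡_) is →
             x i ≤ sum (map x is)
  term≤sum x {i} {is = _ ∷ is} (Any.here refl) q q<xᵢ =
    let r , q<r , r<xᵢ = rounded (x i) q<xᵢ
        b , b<0 , q<r+b = shrink q<r
    in r , b , r<xᵢ , negative (sum (map x is)) b<0 , q<r+b
  term≤sum x {is = j ∷ is} (Any.there i∈is) q q<xᵢ =
    let r , q<r , r<s = rounded (sum (map x is)) (term≤sum x i∈is q q<xᵢ)
        a , a<0 , q<r+a = shrink q<r
    in a , r , negative (x j) a<0 , r<s , subst (q ℚ.<_) (ℚ.+-comm r a) q<r+a

  term≤∑ℕ : ∀ x i → x i ≤ ∑ℕ x
  term≤∑ℕ x i q q<xᵢ = inj₂ (suc i , term≤sum x (∈-upTo⁺ ℕ.≤-refl) q q<xᵢ)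

-- Convergence in the order topology of [0,∞], so that x = ∞ is allowed.
_⟶_ : (ℕ → [0,∞]) → [0,∞] → Set₁
a ⟶ x = (∀ y → y < x → ∃[ N ] (∀ t → N ℕ.≤ t → y < a t))
      × (∀ y → x < y → ∃[ N ] (∀ t → N ℕ.≤ t → a t < y))

record ℝ : Set₁ where
  field
    L U       : ℚ → Set
    L-inhab   : ∃[ q ] L q
    U-inhab   : ∃[ q ] U q
    L-down    : ∀ {p q} → p ℚ.< q → L q → L p
    U-up      : ∀ {p q} → p ℚ.< q → U p → U q
    L-rounded : ∀ {q} → L q → ∃[ r ] (q ℚ.< r × L r)
    U-rounded : ∀ {q} → U q → ∃[ r ] (r ℚ.< q × U r)
    disjoint  : ∀ {q} → L q → U q → ⊥
    located   : ∀ {p q} → p ℚ.< q → L p ⊎ U q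

infix 4 _≈ℝ_ _≈ⁿ_

_≈ℝ_ : ℝ → ℝ → Set
x ≈ℝ y = (∀ q → ℝ.L x q ⇔ ℝ.L y q) × (∀ q → ℝ.U x q ⇔ ℝ.U y q)

ℝ^ : ℕ → Set₁
ℝ^ n = Vector ℝ n

ℚ^ : ℕ → Set
ℚ^ n = Vec ℚ n

_≈ⁿ_ : ∀ {n} → ℝ^ n → ℝ^ n → Set
_≈ⁿ_ = Pointwise _≈ℝ_

≈ℝ-trans : ∀ {x y z} → x ≈ℝ y → y ≈ℝ z → x ≈ℝ z
≈ℝ-trans (l , u) (l' , u') =
    (λ q → mk⇔ (to (l' q) ∘ to (l q)) (from (l q) ∘ from (l' q)))
  , (λ q → mk⇔ (to (u' q) ∘ to (u q)) (from (u q) ∘ from (u' q)))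
  where open Equivalence

≈ℝ-sym : ∀ {x y} → x ≈ℝ y → y ≈ℝ x
≈ℝ-sym (l , u) = (λ q → mk⇔ (from (l q)) (to (l q)))
               , (λ q → mk⇔ (from (u q)) (to (u q)))
  where open Equivalence

≈ⁿ-trans : ∀ {n} {x y z : ℝ^ n} → x ≈ⁿ y → y ≈ⁿ z → x ≈ⁿ z
≈ⁿ-trans {x = x} {y} {z} x≈y y≈z i = ≈ℝ-trans {x i} {y i} {z i} (x≈y i) (y≈z i)

≈ⁿ-sym : ∀ {n} {x y : ℝ^ n} → x ≈ⁿ y → y ≈ⁿ x
≈ⁿ-sym {x = x} {y} x≈y i = ≈ℝ-sym {x i} {y i} (x≈y i)

ratℝ : ℚ → ℝ
ratℝ r = record
  { L         = ℚ._< r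
  ; U         = r ℚ.<_
  ; L-inhab   = r ℚ.- 1ℚ
              , subst (r ℚ.- 1ℚ ℚ.<_) (ℚ.+-identityʳ r)
                  (ℚ.+-monoʳ-< r (ℚ.negative⁻¹ (ℚ.- 1ℚ)))
  ; U-inhab   = r ℚ.+ 1ℚ
              , subst (ℚ._< r ℚ.+ 1ℚ) (ℚ.+-identityʳ r)
                  (ℚ.+-monoʳ-< r (ℚ.positive⁻¹ 1ℚ))
  ; L-down    = ℚ.<-trans
  ; U-up      = λ p<q r<p → ℚ.<-trans r<p p<q
  ; L-rounded = ℚ.<-dense
  ; U-rounded = λ r<q → let s , r<s , s<q = ℚ.<-dense r<q in s , s<q , r<s
  ; disjoint  = ℚ.<-asym
  ; located   = loc
  }
  where
  loc : ∀ {p q} → p ℚ.< q → p ℚ.< r ⊎ r ℚ.< q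
  loc {p} p<q with ℚ.<-cmp p r
  ... | tri< p<r _ _ = inj₁ p<r
  ... | tri≈ _ p≡r _ = inj₂ (subst (ℚ._< _) p≡r p<q)
  ... | tri> _ _ r<p = inj₂ (ℚ.<-trans r<p p<q)

rat : ∀ {n} → ℚ^ n → ℝ^ n
rat q i = ratℝ (Vec.lookup q i)

infix 4 _∈_ _⊆_

record 𝒫 (n : ℕ) : Set₁ where
  field
    Member : ℝ^ n → Set
    resp   : Member Respects _≈ⁿ_

_∈_ : ∀ {n} → ℝ^ n → 𝒫 n → Set
x ∈ E = 𝒫.Member E x

_⊆_ : ∀ {n} → 𝒫 n → 𝒫 n → Set₁
E ⊆ F = ∀ x → x ∈ E → x ∈ F

∅ : ∀ {n} → 𝒫 n
∅ = record { Member = λ _ → ⊥ ; resp = λ _ → id }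

⋃ : ∀ {n} → (ℕ → 𝒫 n) → 𝒫 n
⋃ E = record
  { Member = λ x → ∃[ i ] (x ∈ E i)
  ; resp   = λ x≈y (i , h) → i , 𝒫.resp (E i) x≈y h
  }

∁ : ∀ {n} → 𝒫 n → 𝒫 n
∁ E = record
  { Member = λ x → ¬ (x ∈ E)
  ; resp   = λ {x} {y} x≈y x∉E y∈E →
               x∉E (𝒫.resp E (≈ⁿ-sym {x = x} {y} x≈y) y∈E)
  }

ℚⁿ : ∀ {n} → 𝒫 n
ℚⁿ = record
  { Member = λ x → ∃[ q ] (rat q ≈ⁿ x)
  ; resp   = λ {x} {y} x≈y (q , h) → q , ≈ⁿ-trans {x = rat q} {x} {y} h x≈y
  }

finite : ∀ {n} → List (ℚ^ n) → 𝒫 n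
finite A = record
  { Member = λ x → Any (λ q → rat q ≈ⁿ x) A
  ; resp   = λ {x} {y} x≈y →
               Any.map λ {q} h → ≈ⁿ-trans {x = rat q} {x} {y} h x≈y
  }

⟦_⟧ : ∀ {n} → ℚ^ n → 𝒫 n
⟦ q ⟧ = finite (q ∷ [])

record Encodable (A : Set) : Set where
  field code : A → ℕ

open Encodable {{...}} public

-- The Cantor pairing function (a + b)(a + b + 1)/2 + b.
pair : ℕ → ℕ → ℕ
pair a b = triangle (a ℕ.+ b) ℕ.+ b
  where
  triangle : ℕ → ℕ
  triangle zero    = zero
  triangle (suc k) = suc k ℕ.+ triangle k

codeℤ : ℤ → ℕ
codeℤ (+ k)    = 2 ℕ.* k
codeℤ -[1+ k ] = suc (2 ℕ.* k)

codeVec : ∀ {A n} → {{Encodable A}} → Vec A n → ℕ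
codeVec []       = 0
codeVec (x ∷ xs) = pair (code x) (codeVec xs)

codeList : ∀ {A} → {{Encodable A}} → List A → ℕ
codeList []       = 0
codeList (x ∷ xs) = suc (pair (code x) (codeList xs))

instance
  encodableℚ : Encodable ℚ
  encodableℚ = record
    { code = λ q → pair (codeℤ (ℚ.numerator q)) (ℚ.denominator-1 q) }

  encodableVec : ∀ {A n} → {{Encodable A}} → Encodable (Vec A n)
  encodableVec = record { code = codeVec }

  encodableList : ∀ {A} → {{Encodable A}} → Encodable (List A)
  encodableList = record { code = codeList }

-- ℕᵇ is bijective base 2, so reading off its digits is the standard
-- bijection between ℕ and the set of all binary strings.
digits : ℕᵇ → List Bool
digits ℕᵇ.zero  = []
digits 1+[2 x ] = false ∷ digits x
digits 2[1+ x ] = true ∷ digits x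

string : ∀ {A} → {{Encodable A}} → A → List Bool
string x = digits (fromℕ (code x))

-- Kleene's partial recursive functions; f ⟨ xs ⟩↓ y says that f is
-- defined at xs with value y.
data Recursive : ℕ → Set where
  zeroᵣ : ∀ {k} → Recursive k
  sucᵣ  : Recursive 1
  projᵣ : ∀ {k} → Fin k → Recursive k
  compᵣ : ∀ {k l} → Recursive l → Vec (Recursive k) l → Recursive k
  precᵣ : ∀ {k} → Recursive k → Recursive (2 ℕ.+ k) → Recursive (suc k)
  minᵣ  : ∀ {k} → Recursive (suc k) → Recursive k

infix 4 _⟨_⟩↓_ _⟨_⟩↓*_

mutual
  data _⟨_⟩↓_ : ∀ {k} → Recursive k → Vec ℕ k → ℕ → Set where
    ↓zero : ∀ {k} {xs : Vec ℕ k} → zeroᵣ ⟨ xs ⟩↓ 0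
    ↓suc  : ∀ {x} → sucᵣ ⟨ x ∷ [] ⟩↓ suc x
    ↓proj : ∀ {k} {i : Fin k} {xs} → projᵣ i ⟨ xs ⟩↓ Vec.lookup xs i
    ↓comp : ∀ {k l} {f : Recursive l} {gs : Vec (Recursive k) l} {xs ys z} →
            gs ⟨ xs ⟩↓* ys → f ⟨ ys ⟩↓ z → compᵣ f gs ⟨ xs ⟩↓ z
    ↓prec-zero : ∀ {k} {f : Recursive k} {g xs y} →
            f ⟨ xs ⟩↓ y → precᵣ f g ⟨ 0 ∷ xs ⟩↓ y
    ↓prec-suc : ∀ {k} {f : Recursive k} {g xs m y z} →
            precᵣ f g ⟨ m ∷ xs ⟩↓ y → g ⟨ m ∷ y ∷ xs ⟩↓ z →
            precᵣ f g ⟨ suc m ∷ xs ⟩↓ z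
    ↓min  : ∀ {k} {f : Recursive (suc k)} {xs y} →
            f ⟨ y ∷ xs ⟩↓ 0 →
            (∀ m → m ℕ.< y → ∃[ v ] (f ⟨ m ∷ xs ⟩↓ suc v)) →
            minᵣ f ⟨ xs ⟩↓ y

  data _⟨_⟩↓*_ {k : ℕ} : ∀ {l} → Vec (Recursive k) l → Vec ℕ k → Vec ℕ l → Set where
    []  : ∀ {xs} → [] ⟨ xs ⟩↓* []
    _∷_ : ∀ {l} {g : Recursive k} {gs : Vec (Recursive k) l} {xs y ys} →
          g ⟨ xs ⟩↓ y → gs ⟨ xs ⟩↓* ys → (g ∷ gs) ⟨ xs ⟩↓* (y ∷ ys)

Computable : ∀ {A B} → {{Encodable A}} → {{Encodable B}} → (A → ℕ → B) → Set
Computable f = ∃[ e ] (∀ a t → e ⟨ code a ∷ t ∷ [] ⟩↓ code (f a t))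

record OuterMeasure (n : ℕ) : Set₁ where
  field
    μ           : 𝒫 n → [0,∞]
    μ-∅         : μ ∅ ≈ 0∞
    monotone    : ∀ E F → E ⊆ F → μ E ≤ μ F
    subadditive : ∀ (E : ℕ → 𝒫 n) → μ (⋃ E) ≤ ∑ℕ (λ i → μ (E i))

open OuterMeasure public

module _ {n : ℕ} (m : OuterMeasure n) where

  Supported : Set
  Supported = μ m (∁ ℚⁿ) ≈ 0∞

  FinitelySupported : Set₁
  FinitelySupported = ∀ ε → ε ∈⟨0,∞⟩ →
    ∃[ A ] (μ m (∁ (finite A)) < ε)

  StronglyFinite : Set
  StronglyFinite = Supported × ∑ (λ (q : ℚ^ n) → μ m ⟦ q ⟧) < ∞

  -- A function on finite subsets of ℚⁿ is a function on lists that is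
  -- invariant under set equality of lists.
  record LowerSemicomputable : Set₁ where
    field
      finitelySupported : FinitelySupported
      μ̂                 : List (ℚ^ n) → ℕ → ℚ
      μ̂-set             : ∀ {A B} t → A ∼[ set ] B → μ̂ A t ≡ μ̂ B t
      {{μ̂-nonNeg}}      : ∀ {A t} → NonNegative (μ̂ A t)
      computable        : Computable μ̂
      increasing        : ∀ A {s t} → s ℕ.≤ t → μ̂ A s ℚ.≤ μ̂ A t
      bounded           : ∀ A t → fromℚ (μ̂ A t) ≤ μ m (finite A)
      converges         : ∀ A → (λ t → fromℚ (μ̂ A t)) ⟶ μ m (finite A)

GloballyOptimal : ∀ {n} → OuterMeasure n → Set₁
GloballyOptimal {n} m =
    (StronglyFinite m × LowerSemicomputable m)
  × (∀ (ν : OuterMeasure n) → StronglyFinite ν → LowerSemicomputable ν →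
       ∃[ β ] (β ∈⟨0,∞⟩ × (∀ E → β * μ ν E ≤ μ m E)))

data Symbol (k : ℕ) : Set where
  blank : Symbol k
  bit   : Bool → Symbol k
  extra : Fin k → Symbol k

data Direction : Set where
  left right : Direction

-- All cells beyond the two lists are blank; the list ls of cells to the
-- left of the head starts with the one nearest to the head.
record Configuration (State Symbol : Set) : Set where
  constructor ⟨_,_,_,_⟩
  field
    state : State
    ls    : List Symbol
    head  : Symbol
    rs    : List Symbol

-- Deterministic, with one two-way infinite tape; the machine halts when
-- δ yields nothing.
record TuringMachine : Set where
  field
    states extras : ℕ

  State = Fin (suc states)
  Sym   = Symbol extras

  field
    δ : State → Sym → Maybe (State × Sym × Direction)

  Config = Configuration State Sym

  move : State → Sym → Direction → List Sym → List Sym → Config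
  move q s right ls []       = ⟨ q , s ∷ ls , blank , [] ⟩
  move q s right ls (r ∷ rs) = ⟨ q , s ∷ ls , r , rs ⟩
  move q s left  []       rs = ⟨ q , [] , blank , s ∷ rs ⟩
  move q s left  (l ∷ ls) rs = ⟨ q , ls , l , s ∷ rs ⟩

  step : Config → Maybe Config
  step ⟨ q , ls , h , rs ⟩ with δ q h
  ... | nothing          = nothing
  ... | just (q' , s , d) = just (move q' s d ls rs)

  initial : List Bool → Config
  initial []      = ⟨ zero , [] , blank , [] ⟩
  initial (b ∷ π) = ⟨ zero , [] , bit b , map bit π ⟩

  bits : List Sym → List Bool
  bits (bit b ∷ ss) = b ∷ bits ss
  bits _            = []

  -- The maximal block of bits that starts at the head and extends to the right.
  output : Config → List Bool
  output ⟨ _ , _ , h , rs ⟩ = bits (h ∷ rs)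

  run : ℕ → Config → Maybe (List Bool)
  run zero    c = nothing
  run (suc t) c with step c
  ... | nothing = just (output c)
  ... | just c' = run t c'

infix 4 _⟪_⟫=_

_⟪_⟫=_ : TuringMachine → List Bool → List Bool → Set
M ⟪ π ⟫= w = ∃[ t ] (run t (initial π) ≡ just w)
  where open TuringMachine M

IsPrefixMachine : TuringMachine → Set
IsPrefixMachine M = ∀ π π' w w' → M ⟪ π ⟫= w → M ⟪ π' ⟫= w' →
  Prefix _≡_ π π' → π ≡ π'

IsUniversalPrefixMachine : TuringMachine → Set
IsUniversalPrefixMachine U = IsPrefixMachine U ×
  (∀ M → IsPrefixMachine M → ∃[ c ] (∀ π w → M ⟪ π ⟫= w →
     ∃[ π' ] (U ⟪ π' ⟫= w × length π' ℕ.≤ length π ℕ.+ c)))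

½^_ : ℕ → ℚ
½^ zero  = 1ℚ
½^ suc k = ½ ℚ.* ½^ k

instance
  ½^-nonNeg : ∀ {k} → NonNegative (½^ k)
  ½^-nonNeg {zero}  = _
  ½^-nonNeg {suc k} = ℚ.nonNeg*nonNeg⇒nonNeg ½ (½^ k) {{½^-nonNeg {k}}}

-- ℕ ⁺ is ℕ ∪ {∞}, with ⊤⁺ = ∞.
2^-_ : ℕ ⁺ → [0,∞]
2^- [ k ] = fromℚ (½^ k) {{½^-nonNeg {k}}}
2^- ⊤⁺    = 0∞

IsMinimum : (ℕ → Set) → ℕ → Set
IsMinimum P k = P k × (∀ j → P j → k ℕ.≤ j)

-- Excluded middle turns the minimum of an undecidable set of natural
-- numbers, and hence K and κ, into functions.
module Kolmogorov (em : ExcludedMiddle 0ℓ) (U : TuringMachine) where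

  -- The minimum of { k ∣ P k }, with min ∅ = ∞.
  min : (ℕ → Set) → ℕ ⁺
  min P with em {∃ (IsMinimum P)}
  ... | yes (k , _) = [ k ]
  ... | no  _       = ⊤⁺

  Kstring : List Bool → ℕ ⁺
  Kstring w = min λ k → ∃[ π ] (U ⟪ π ⟫= w × length π ≡ k)

  Kpoint : ∀ {n} → ℚ^ n → ℕ ⁺
  Kpoint q = Kstring (string q)

  -- Points q with K(q) = ∞ do not affect the minimum.
  K : ∀ {n} → 𝒫 n → ℕ ⁺
  K {n} E = min λ k → ∃[ q ] (rat {n} q ∈ E × Kpoint q ≡ [ k ])

  private
    least : ∀ P k → P k → ∃ (IsMinimum P)
    least P = ℕ.<-rec (λ k → P k → ∃ (IsMinimum P)) smaller
      where
      smaller : ∀ k → (∀ {j} → j ℕ.< k → P j → ∃ (IsMinimum P)) →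
                P k → ∃ (IsMinimum P)
      smaller k rec pk with em {∃[ j ] (j ℕ.< k × P j)}
      ... | yes (j , j<k , pj) = rec j<k pj
      ... | no none = k , pk , λ j pj → ℕ.≮⇒≥ λ j<k → none (j , j<k , pj)

    min-attained : ∀ P {k} → min P ≡ [ k ] → P k
    min-attained P eq with em {∃ (IsMinimum P)}
    min-attained P refl | yes (_ , pk , _) = pk

    ½^-anti : ∀ {j k} → j ℕ.≤ k → ½^ k ℚ.≤ ½^ j
    ½^-anti {j} j≤k = go (ℕ.≤⇒≤′ j≤k)
      where
      go : ∀ {k} → j ℕ.≤′ k → ½^ k ℚ.≤ ½^ j
      go ℕ.≤′-refl = ℚ.≤-refl
      go {suc k} (ℕ.≤′-step j≤k) = ℚ.≤-trans
        (subst (½ ℚ.* ½^ k ℚ.≤_) (ℚ.*-identityˡ (½^ k))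
          (ℚ.*-monoʳ-≤-nonNeg (½^ k) {{½^-nonNeg {k}}} ½≤1))
        (go j≤k)
        where
        ½≤1 : ½ ℚ.≤ 1ℚ
        ½≤1 = toWitness {a? = ½ ℚ.≤? 1ℚ} _

    2^-min-≥ : ∀ P {k} → P k → 2^- [ k ] ≤ 2^- (min P)
    2^-min-≥ P {k} pk q q<2^-k with em {∃ (IsMinimum P)}
    ... | yes (j , _ , j-least) = ℚ.<-≤-trans q<2^-k (½^-anti (j-least k pk))
    ... | no none               = ⊥-elim (none (least P k pk))

    2^-min-≤ : ∀ P x → (∀ k → P k → 2^- [ k ] ≤ x) → 2^- (min P) ≤ x
    2^-min-≤ P x bound with min P in eq
    ... | [ k ] = bound k (min-attained P eq)
    ... | ⊤⁺    = λ _ → negative x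

  κ : ∀ n → OuterMeasure n
  κ n = record
    { μ           = λ E → 2^- K E
    ; μ-∅         = 2^-min-≤ (values ∅) 0∞ (λ _ ())
                  , λ _ → negative (2^- K {n} ∅)
    ; monotone    = λ E F E⊆F → 2^-min-≤ (values E) (2^- K F) λ k (q , q∈E , eq) →
                      2^-min-≥ (values F) (q , E⊆F _ q∈E , eq)
    ; subadditive = λ E → 2^-min-≤ (values (⋃ E)) (∑ℕ λ i → 2^- K (E i))
                      λ k (q , (i , q∈Eᵢ) , eq) p p<2^-k →
                        term≤∑ℕ (λ i → 2^- K (E i)) i p
                          (2^-min-≥ (values (E i)) (q , q∈Eᵢ , eq) p p<2^-k)
    }
    where
    values : 𝒫 n → ℕ → Set
    values E k = ∃[ q ] (rat q ∈ E × Kpoint q ≡ [ k ])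

{-# OPTIONS --safe #-}

-- κ is the supremum of its values on singletons, while a strongly finite
-- outer measure may add up.  Let ν give every rational point p_j with
-- j < 4^t the weight 8^-(t+1), summed over all t.  If the sum of the
-- κ(p_j) is at most S, then at least half of the points p_j with j < 4^t
-- satisfy κ(p_j) ≤ θ := 2S/4^t.  Hence κ(E) ≤ θ = O(4^-t) for the set E of
-- all points with κ(q) ≤ θ, whereas ν(E) ≥ 4^t/(2·8^(t+1)) is of order 2^-t.
module Submission where

open import Axiom.ExcludedMiddle using (ExcludedMiddle)
open import Data.Fin as Fin using (Fin)
open import Data.Integer as ℤ using (ℤ; +_; -[1+_])
import Data.Integer.Properties as ℤ
open import Data.Integer.Tactic.RingSolver using (solve-∀)
open import Data.List as List using (List; []; _∷_; map; upTo)
open import Data.List.Membership.Propositional using () renaming (_∈_ to _∈ᴸ_)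
open import Data.List.Membership.Propositional.Properties using (∈-upTo⁺; ∈-map⁺)
open import Data.List.Properties using (map-∘)
open import Data.List.Relation.Unary.All as All using (All; []; _∷_)
import Data.List.Relation.Unary.All.Properties as All
open import Data.List.Relation.Unary.AllPairs using ([]; _∷_)
open import Data.List.Relation.Unary.Any as Any using (here; there)
open import Data.List.Relation.Unary.Unique.Propositional using (Unique)
open import Data.List.Relation.Unary.Unique.Propositional.Properties using (map⁺)
open import Data.Nat as ℕ using (ℕ; zero; suc; _+_; _*_; _∸_; _^_; _≤_; _<_; _≥_; z≤n; s≤s; _⊔_)
open import Data.Nat.Coprimality using (Coprime; coprime-divisor)
open import Data.Nat.Divisibility using (_∣_; ∣m+n∣m⇒∣n; n∣m*n; ∣1⇒≡1; ∣-trans)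
open import Data.Nat.ListAction using () renaming (sum to sumℕ)
open import Data.Nat.Properties
import Data.Nat.Tactic.RingSolver as ℕ
open import Data.Product using (∃; ∃-syntax; _×_; _,_; proj₁; proj₂)
open import Data.Rational as ℚ using (ℚ; mkℚ; 0ℚ; toℚᵘ)
import Data.Rational.Properties as ℚ
open import Data.Rational.Unnormalised as ℚᵘ using (mkℚᵘ; *≡*; *≤*; *<*)
import Data.Rational.Unnormalised.Properties as ℚᵘ
open import Data.Sum using (inj₁; inj₂)
open import Data.Unit using (tt)
open import Data.Vec as Vec using (Vec; []; _∷_; lookup; replicate; tabulate)
open import Data.Vec.Properties using (tabulate∘lookup)
open import Function using (_∘_; id; Equivalence; mk⇔)
open import Level using (0ℓ)
open import Relation.Binary using (tri<; tri≈; tri>)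
open import Relation.Binary.PropositionalEquality
open import Relation.Nullary using (¬_; contradiction; yes; no)
open import Relation.Nullary.Construct.Add.Supremum using (⊤⁺; [_])
import Defs as D
open import Defs hiding (_≤_; _<_; _+_; _*_; sum)

-- Programs for primitive recursive functions

-- The bases 4 and 8 balance two demands: the masses 4^t / 8^(t+1) = 2^-t / 8 must be summable, yet
-- must exceed the threshold of order 4^-t by an unbounded factor, so that every β > 0 is beaten at
-- some t. The obstacle is the lower semicomputability of ν. A rational is coded by its reduced
-- numerator and denominator, so a program that returned a partial sum over 8^t would have to cancel
-- common factors. Every nonzero partial sum is therefore lowered by 1/64^t, which puts it in lowest
-- terms and keeps both monotonicity in t and the limit. Membership of p_j in an arbitrary set is
-- settled by excluded middle; for a finite set it becomes a comparison of codes, which a program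
-- can carry out.

natrec : ℕ → (ℕ → ℕ → ℕ) → ℕ → ℕ
natrec b s zero    = b
natrec b s (suc m) = s m (natrec b s m)

sumTo : ℕ → (ℕ → ℕ) → ℕ
sumTo m f = natrec 0 (λ j y → y + f j) m

sg : ℕ → ℕ
sg = natrec 0 (λ _ _ → 1)

equal lessEq : ℕ → ℕ → ℕ
equal x y = 1 ∸ (x ∸ y + (y ∸ x))
lessEq x y = 1 ∸ (x ∸ y)

-- Index and correctness proof travel together, so the closure lemmas build both at once and no
-- program is written out by hand.
IsRec : ∀ {k} → (Vec ℕ k → ℕ) → Set
IsRec {k} f = ∃[ e ] (∀ xs → e ⟨ xs ⟩↓ f xs)

private variable
  k l : ℕ
  f g b : Vec ℕ k → ℕ

-- The induction is on the number of projections while the arity stays fixed, hence the arbitrary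
-- renaming `ρ`: `id` passes on all arguments, successor maps drop leading ones.
projections : (ρ : Fin l → Fin k) (xs : Vec ℕ k) →
  tabulate (projᵣ ∘ ρ) ⟨ xs ⟩↓* tabulate (lookup xs ∘ ρ)
projections {l = zero}  ρ xs = []
projections {l = suc l} ρ xs = ↓proj ∷ projections (ρ ∘ Fin.suc) xs

≗-rec : (∀ xs → f xs ≡ g xs) → IsRec f → IsRec g
≗-rec f≗g (e , ↓f) = e , λ xs → subst (e ⟨ xs ⟩↓_) (f≗g xs) (↓f xs)

var : (i : Fin k) → IsRec (λ xs → lookup xs i)
var i = projᵣ i , λ _ → ↓proj

suc-rec : IsRec f → IsRec (suc ∘ f)
suc-rec (e , ↓f) = compᵣ sucᵣ (e ∷ []) , λ xs → ↓comp (↓f xs ∷ []) ↓suc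

const-rec : (n : ℕ) → IsRec {k} (λ _ → n)
const-rec zero    = zeroᵣ , λ _ → ↓zero
const-rec (suc n) = suc-rec (const-rec n)

natrec-rec : {s : Vec ℕ (2 + k) → ℕ} → IsRec b → IsRec s → IsRec g →
  IsRec (λ xs → natrec (b xs) (λ m y → s (m ∷ y ∷ xs)) (g xs))
natrec-rec {b = b} {s = s} (eb , ↓b) (es , ↓s) (eg , ↓g) =
  compᵣ (precᵣ eb es) (eg ∷ tabulate projᵣ) , λ xs →
    ↓comp (↓g xs ∷ subst (tabulate projᵣ ⟨ xs ⟩↓*_) (tabulate∘lookup xs) (projections id xs))
          (loop xs _)
  where
  loop : ∀ xs m → precᵣ eb es ⟨ m ∷ xs ⟩↓ natrec (b xs) (λ m y → s (m ∷ y ∷ xs)) m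
  loop xs zero    = ↓prec-zero (↓b xs)
  loop xs (suc m) = ↓prec-suc (loop xs m) (↓s _)

+-rec : IsRec f → IsRec g → IsRec (λ xs → f xs + g xs)
+-rec {f = f} {g = g} F G =
  ≗-rec (λ xs → eq (f xs) (g xs)) (natrec-rec G (suc-rec (var (Fin.suc Fin.zero))) F)
  where
  eq : ∀ m n → natrec n (λ _ y → suc y) m ≡ m + n
  eq zero    n = refl
  eq (suc m) n = cong suc (eq m n)

weaken : ∀ {k} {f : Vec ℕ k → ℕ} → IsRec f → IsRec (f ∘ Vec.tail)
weaken (e , ↓f) = compᵣ e (tabulate (projᵣ ∘ Fin.suc)) , λ where
  xs@(x ∷ zs) → ↓comp
    (subst (_ ⟨ xs ⟩↓*_) (tabulate∘lookup zs) (projections Fin.suc xs)) (↓f zs)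

-- In the recursion behind `sumTo` the accumulator stands second, and the summand must not see it.
drop₂-rec : ∀ {k} {f : Vec ℕ (suc k) → ℕ} → IsRec f → IsRec (λ xs → f (Vec.head xs ∷ Vec.tail (Vec.tail xs)))
drop₂-rec (e , ↓f) = compᵣ e (projᵣ Fin.zero ∷ tabulate (projᵣ ∘ Fin.suc ∘ Fin.suc)) , λ where
  xs@(x ∷ y ∷ zs) → ↓comp
    (↓proj ∷ subst (_ ⟨ xs ⟩↓*_) (tabulate∘lookup zs) (projections (Fin.suc ∘ Fin.suc) xs))
    (↓f (x ∷ zs))

sumTo-rec : ∀ {k} {g : Vec ℕ k → ℕ} {f : Vec ℕ (suc k) → ℕ} → IsRec g → IsRec f →
  IsRec (λ xs → sumTo (g xs) (λ j → f (j ∷ xs)))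
sumTo-rec G F = natrec-rec (const-rec 0) (+-rec (var (Fin.suc Fin.zero)) (drop₂-rec F)) G

*-rec : IsRec f → IsRec g → IsRec (λ xs → f xs * g xs)
*-rec {f = f} {g = g} F G =
  ≗-rec (λ xs → eq (f xs) (g xs)) (natrec-rec (const-rec 0) (+-rec (weaken (weaken G)) (var (Fin.suc Fin.zero))) F)
  where
  eq : ∀ m n → natrec 0 (λ _ y → n + y) m ≡ m * n
  eq zero    n = refl
  eq (suc m) n = cong (λ x → n + x) (eq m n)

^-rec : ∀ c → IsRec f → IsRec (λ xs → c ^ f xs)
^-rec {f = f} c F =
  ≗-rec (λ xs → eq (f xs)) (natrec-rec (const-rec 1) (*-rec (const-rec c) (var (Fin.suc Fin.zero))) F)
  where
  eq : ∀ m → natrec 1 (λ _ y → c * y) m ≡ c ^ m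
  eq zero    = refl
  eq (suc m) = cong (c *_) (eq m)

pred-rec : IsRec f → IsRec (λ xs → ℕ.pred (f xs))
pred-rec {f = f} F =
  ≗-rec (λ xs → eq (f xs)) (natrec-rec (const-rec 0) (var Fin.zero) F)
  where
  eq : ∀ m → natrec 0 (λ m _ → m) m ≡ ℕ.pred m
  eq zero    = refl
  eq (suc m) = refl

∸-rec : IsRec f → IsRec g → IsRec (λ xs → f xs ∸ g xs)
∸-rec {f = f} {g = g} F G =
  ≗-rec (λ xs → eq (f xs) (g xs)) (natrec-rec F (pred-rec (var (Fin.suc Fin.zero))) G)
  where
  eq : ∀ m n → natrec m (λ _ y → ℕ.pred y) n ≡ m ∸ n
  eq m zero    = refl
  eq m (suc n) = trans (cong ℕ.pred (eq m n)) (pred[m∸n]≡m∸[1+n] m n)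

sg-rec : IsRec f → IsRec (sg ∘ f)
sg-rec = natrec-rec (const-rec 0) (const-rec 1)

equal-rec : IsRec f → IsRec g → IsRec (λ xs → equal (f xs) (g xs))
equal-rec F G = ∸-rec (const-rec 1) (+-rec (∸-rec F G) (∸-rec G F))

lessEq-rec : IsRec f → IsRec g → IsRec (λ xs → lessEq (f xs) (g xs))
lessEq-rec F G = ∸-rec (const-rec 1) (∸-rec F G)

-- Inversion of the Cantor pairing

tri : ℕ → ℕ
tri = natrec 0 (λ m y → suc m + y)

-- The meta is solved by the where-function of pair, which is not in scope by name.
mutual
  triangle : ℕ → ℕ → ℕ → ℕ
  triangle = _

  pair-triangle : ∀ a b → pair a b ≡ triangle a b (a + b) + b
  pair-triangle a b with a + b
  ... | w = refl

pair≡ : ∀ a b → pair a b ≡ tri (a + b) + b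
pair≡ a b = trans (pair-triangle a b) (cong (_+ b) (triangle≡tri (a + b)))
  where
  triangle≡tri : ∀ k → triangle a b k ≡ tri k
  triangle≡tri zero    = refl
  triangle≡tri (suc k) = cong (λ x → suc k + x) (triangle≡tri k)

-- `root n` is the largest `r` with `tri r ≤ n`, the antidiagonal of the pair coded by `n`. From `m`
-- to `suc m` it grows by at most one, and `lessEq` supplies that increment.
root fst snd : ℕ → ℕ
root = natrec 0 (λ m r → r + lessEq (tri (suc r)) (suc m))
snd n = n ∸ tri (root n)
fst n = root n ∸ snd n

tri-mono : ∀ {m n} → m ≤ n → tri m ≤ tri n
tri-mono {n = n}     z≤n       = z≤n
tri-mono             (s≤s m≤n) = +-mono-≤ (s≤s m≤n) (tri-mono m≤n)

IsRoot : ℕ → ℕ → Set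
IsRoot n r = tri r ≤ n × n < tri (suc r)

lessEq-yes : ∀ {x y} → x ≤ y → lessEq x y ≡ 1
lessEq-yes {x} {y} x≤y = cong (1 ∸_) (m≤n⇒m∸n≡0 x≤y)

lessEq-no : ∀ {x y} → y < x → lessEq x y ≡ 0
lessEq-no {x} {y} y<x = m≤n⇒m∸n≡0 (m<n⇒0<n∸m y<x)

root-isRoot : ∀ n → IsRoot n (root n)
root-isRoot zero    = z≤n , s≤s z≤n
root-isRoot (suc n) with root-isRoot n | tri (suc (root n)) ℕ.≤? suc n
... | lo , hi | yes p =
      subst (IsRoot (suc n)) (sym (trans (cong (λ x → root n + x) (lessEq-yes p)) (+-comm (root n) 1)))
        (p , s≤s (≤-trans hi (m≤n+m _ (suc (root n)))))
... | lo , hi | no ¬p =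
      subst (IsRoot (suc n)) (sym (trans (cong (λ x → root n + x) (lessEq-no (≰⇒> ¬p))) (+-identityʳ (root n))))
        (≤-trans lo (n≤1+n n) , ≰⇒> ¬p)

root-unique : ∀ {n r s} → IsRoot n r → IsRoot n s → r ≡ s
root-unique {n} {r} {s} (lo , hi) (lo′ , hi′) with <-cmp r s
... | tri< r<s _ _ = contradiction (≤-trans (tri-mono r<s) lo′) (<⇒≱ hi)
... | tri≈ _ eq _  = eq
... | tri> _ _ s<r = contradiction (≤-trans (tri-mono s<r) lo) (<⇒≱ hi′)

-- The codes on the antidiagonal `a + b = r` run from `tri r` to `tri r + r`, hence stay below
-- `tri (suc r)`.
root-pair : ∀ a b → root (pair a b) ≡ a + b
root-pair a b rewrite pair≡ a b = root-unique (root-isRoot _)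
  ( m≤m+n _ b
  , subst (tri (a + b) + b <_) (+-comm (tri (a + b)) (suc (a + b)))
      (+-monoʳ-< (tri (a + b)) (s≤s (m≤n+m b a))))

snd-pair : ∀ a b → snd (pair a b) ≡ b
snd-pair a b rewrite root-pair a b | pair≡ a b = m+n∸m≡n (tri (a + b)) b

fst-pair : ∀ a b → fst (pair a b) ≡ a
fst-pair a b rewrite snd-pair a b | root-pair a b = m+n∸n≡m a b

tri-rec : IsRec f → IsRec (tri ∘ f)
tri-rec = natrec-rec (const-rec 0) (+-rec (suc-rec (var Fin.zero)) (var (Fin.suc Fin.zero)))

root-rec : IsRec f → IsRec (root ∘ f)
root-rec = natrec-rec (const-rec 0) (+-rec (var (Fin.suc Fin.zero))
  (lessEq-rec (tri-rec (suc-rec (var (Fin.suc Fin.zero)))) (suc-rec (var Fin.zero))))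

snd-rec : IsRec f → IsRec (snd ∘ f)
snd-rec F = ∸-rec F (tri-rec (root-rec F))

fst-rec : IsRec f → IsRec (fst ∘ f)
fst-rec F = ∸-rec (root-rec F) (snd-rec F)

pair-rec : IsRec f → IsRec g → IsRec (λ xs → pair (f xs) (g xs))
pair-rec {f = f} {g = g} F G =
  ≗-rec (λ xs → sym (pair≡ (f xs) (g xs))) (+-rec (tri-rec (+-rec F G)) G)

-- Counting occurrences in a coded list

hd tl : ℕ → ℕ
hd a = fst (ℕ.pred a)
tl a = snd (ℕ.pred a)

dropTo : ℕ → ℕ → ℕ
dropTo a = natrec a (λ _ → tl)

-- The code 0 is the empty list, yet `hd 0` is 0; the factor `sg a` keeps it from counting as an
-- entry.
occursAt : ℕ → ℕ → ℕ
occursAt c a = sg a * equal (hd a) c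

-- A bounded sum replaces recursion on the list: the code bounds the length, and surplus indices
-- reach the code 0, which `tl` fixes.
occurrences : ℕ → ℕ → ℕ
occurrences c a = sumTo a (λ i → occursAt c (dropTo a i))

occurrences-rec : IsRec f → IsRec g → IsRec (λ xs → occurrences (f xs) (g xs))
occurrences-rec {f = f} {g = g} F G =
  sumTo-rec G (occurs (weaken F)
    (natrec-rec (weaken G) (snd-rec (pred-rec (var (Fin.suc Fin.zero)))) (var Fin.zero)))
  where
  occurs : ∀ {k} {f g : Vec ℕ k → ℕ} → IsRec f → IsRec g → IsRec (λ xs → occursAt (f xs) (g xs))
  occurs F G = *-rec (sg-rec G) (equal-rec (fst-rec (pred-rec G)) F)

sumTo-front : ∀ m f → sumTo (suc m) f ≡ f 0 + sumTo m (f ∘ suc)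
sumTo-front zero    f = sym (+-identityʳ (f 0))
sumTo-front (suc m) f = trans (cong (_+ f (suc m)) (sumTo-front m f)) (+-assoc (f 0) _ _)

sumTo-cong : ∀ m {f g} → (∀ j → f j ≡ g j) → sumTo m f ≡ sumTo m g
sumTo-cong zero    eq = refl
sumTo-cong (suc m) eq = cong₂ _+_ (sumTo-cong m eq) (eq m)

dropTo-suc : ∀ a i → dropTo a (suc i) ≡ dropTo (tl a) i
dropTo-suc a zero    = refl
dropTo-suc a (suc i) = cong tl (dropTo-suc a i)

module _ {A : Set} {{_ : Encodable A}} where

  count : ℕ → List A → ℕ
  count c []       = 0
  count c (x ∷ xs) = equal (code x) c + count c xs

  sumTo-occursAt : ∀ c m (xs : List A) → List.length xs ≤ m →
    sumTo m (λ i → occursAt c (dropTo (codeList xs) i)) ≡ count c xs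
  sumTo-occursAt c zero    []       _ = refl
  sumTo-occursAt c (suc m) []       _ =
    trans (sumTo-front m _)
          (trans (sumTo-cong m (λ i → cong (occursAt c) (dropTo-suc 0 i))) (sumTo-occursAt c m [] z≤n))
  sumTo-occursAt c (suc m) (x ∷ xs) (s≤s len≤m) =
    trans (sumTo-front m _) (cong₂ _+_
      (trans (*-identityˡ _) (cong (λ z → equal z c) (fst-pair (code x) (codeList xs))))
      (trans (sumTo-cong m (λ i → cong (occursAt c)
                (trans (dropTo-suc (codeList (x ∷ xs)) i)
                       (cong (λ a → dropTo a i) (snd-pair (code x) (codeList xs))))))
             (sumTo-occursAt c m xs len≤m)))

  length≤code : ∀ (xs : List A) → List.length xs ≤ codeList xs
  length≤code []       = z≤n
  length≤code (x ∷ xs) = s≤s (≤-trans (length≤code xs)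
    (subst (codeList xs ≤_) (sym (pair≡ (code x) _)) (m≤n+m _ _)))

  occurrences-code : ∀ c (xs : List A) → occurrences c (codeList xs) ≡ count c xs
  occurrences-code c xs = sumTo-occursAt c _ xs (length≤code xs)

-- Rationals as fractions of natural numbers

private variable
  m n d e : ℕ
  p q : ℚ

infix 4 _≐_
-- The fraction on the right need not be reduced, so `frac`, `mkℚ` and `approx` can all be compared
-- by cross-multiplication in ℕ.
_≐_ : ℚ → ℚᵘ.ℚᵘ → Set
p ≐ u = toℚᵘ p ℚᵘ.≃ u

-- Abstract, as unfolding the normalisation of fractions is expensive.
abstract
  frac : (m d : ℕ) → .{{ℕ.NonZero d}} → ℚ
  frac m d = + m ℚ./ d

  frac-≐ : ∀ m d → frac m (suc d) ≐ mkℚᵘ (+ m) d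
  frac-≐ m d = ℚ.toℚᵘ-fromℚᵘ (mkℚᵘ (+ m) d)

frac-0 : ∀ d .{{_ : ℕ.NonZero d}} → frac 0 d ≡ 0ℚ
frac-0 (suc d) = ℚ.toℚᵘ-injective (ℚᵘ.≃-trans (frac-≐ 0 d) (*≡* refl))

mkℚ-≐ : ∀ m d .(c : Coprime m (suc d)) → mkℚ (+ m) d c ≐ mkℚᵘ (+ m) d
mkℚ-≐ m d c = ℚᵘ.≃-refl

≐-≤ : p ≐ mkℚᵘ (+ m) d → q ≐ mkℚᵘ (+ n) e → m * suc e ≤ n * suc d → p ℚ.≤ q
≐-≤ {m = m} {d} {n = n} {e} p≐ q≐ h =
  ℚ.toℚᵘ-cancel-≤ (ℚᵘ.≤-respˡ-≃ (ℚᵘ.≃-sym p≐) (ℚᵘ.≤-respʳ-≃ (ℚᵘ.≃-sym q≐)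
    (*≤* (subst₂ ℤ._≤_ (ℤ.pos-* m (suc e)) (ℤ.pos-* n (suc d)) (ℤ.+≤+ h)))))

≐-< : p ≐ mkℚᵘ (+ m) d → q ≐ mkℚᵘ (+ n) e → m * suc e < n * suc d → p ℚ.< q
≐-< {m = m} {d} {n = n} {e} p≐ q≐ h =
  ℚ.toℚᵘ-cancel-< (ℚᵘ.<-respˡ-≃ (ℚᵘ.≃-sym p≐) (ℚᵘ.<-respʳ-≃ (ℚᵘ.≃-sym q≐)
    (*<* (subst₂ ℤ._<_ (ℤ.pos-* m (suc e)) (ℤ.pos-* n (suc d)) (ℤ.+<+ h)))))

≐-<⁻¹ : p ≐ mkℚᵘ (+ m) d → q ≐ mkℚᵘ (+ n) e → p ℚ.< q → m * suc e < n * suc d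
≐-<⁻¹ {m = m} {d} {n = n} {e} p≐ q≐ h
  with ℚᵘ.<-respˡ-≃ p≐ (ℚᵘ.<-respʳ-≃ q≐ (ℚ.toℚᵘ-mono-< h))
... | *<* lt = ℤ.drop‿+<+ (subst₂ ℤ._<_ (sym (ℤ.pos-* m (suc e))) (sym (ℤ.pos-* n (suc d))) lt)

frac-≤ : ∀ {m d n e} .{{_ : ℕ.NonZero d}} .{{_ : ℕ.NonZero e}} →
  m * e ≤ n * d → frac m d ℚ.≤ frac n e
frac-≤ {m} {suc d} {n} {suc e} = ≐-≤ (frac-≐ m d) (frac-≐ n e)

frac-< : ∀ {m d n e} .{{_ : ℕ.NonZero d}} .{{_ : ℕ.NonZero e}} →
  m * e < n * d → frac m d ℚ.< frac n e
frac-< {m} {suc d} {n} {suc e} = ≐-< (frac-≐ m d) (frac-≐ n e)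

frac-+ : ∀ m n d .{{_ : ℕ.NonZero d}} → frac m d ℚ.+ frac n d ≡ frac (m + n) d
frac-+ m n (suc d) = ℚ.toℚᵘ-injective (begin-equality
  toℚᵘ (frac m (suc d) ℚ.+ frac n (suc d))            ≃⟨ ℚ.toℚᵘ-homo-+ (frac m (suc d)) (frac n (suc d)) ⟩
  toℚᵘ (frac m (suc d)) ℚᵘ.+ toℚᵘ (frac n (suc d))    ≃⟨ ℚᵘ.+-cong (frac-≐ m d) (frac-≐ n d) ⟩
  mkℚᵘ (+ m) d ℚᵘ.+ mkℚᵘ (+ n) d                      ≃⟨ *≡* (eq (+ m) (+ n) (+ suc d)) ⟩
  mkℚᵘ (+ (m + n)) d                                  ≃⟨ ℚᵘ.≃-sym (frac-≐ (m + n) d) ⟩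
  toℚᵘ (frac (m + n) (suc d))                         ∎)
  where
  open ℚᵘ.≤-Reasoning
  eq : ∀ x y z → (x ℤ.* z ℤ.+ y ℤ.* z) ℤ.* z ≡ (x ℤ.+ y) ℤ.* (z ℤ.* z)
  eq = solve-∀

frac-* : ∀ m n d e .{{_ : ℕ.NonZero d}} .{{_ : ℕ.NonZero e}} →
  frac m d ℚ.* frac n e ≡ frac (m * n) (d * e) {{m*n≢0 d e}}
frac-* m n (suc d) (suc e) = ℚ.toℚᵘ-injective (begin-equality
  toℚᵘ (frac m (suc d) ℚ.* frac n (suc e))            ≃⟨ ℚ.toℚᵘ-homo-* (frac m (suc d)) (frac n (suc e)) ⟩
  toℚᵘ (frac m (suc d)) ℚᵘ.* toℚᵘ (frac n (suc e))    ≃⟨ ℚᵘ.*-cong (frac-≐ m d) (frac-≐ n e) ⟩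
  mkℚᵘ (+ m) d ℚᵘ.* mkℚᵘ (+ n) e                      ≃⟨ *≡* (cong (ℤ._* (+ (suc d * suc e))) (sym (ℤ.pos-* m n))) ⟩
  mkℚᵘ (+ (m * n)) (e + d * suc e)                    ≃⟨ ℚᵘ.≃-sym (frac-≐ (m * n) (e + d * suc e)) ⟩
  toℚᵘ (frac (m * n) (suc d * suc e))                 ∎)
  where open ℚᵘ.≤-Reasoning

frac-nonNeg : ∀ m d .{{_ : ℕ.NonZero d}} → 0ℚ ℚ.≤ frac m d
frac-nonNeg m d = subst (ℚ._≤ frac m d) (frac-0 1) (frac-≤ {0} {1} {m} {d} z≤n)

≤⇒≯ℚ : p ℚ.≤ q → ¬ (q ℚ.< p)
≤⇒≯ℚ p≤q q<p = ℚ.<-irrefl refl (ℚ.<-≤-trans q<p p≤q)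

n<2^n : ∀ n → n < 2 ^ n
n<2^n zero    = s≤s z≤n
n<2^n (suc n) = +-mono-≤ (m^n>0 2 n) (≤-trans (n<2^n n) (m≤m+n (2 ^ n) 0))

-- For a nonnegative `q` the numerator serves as exponent, as p < 2^p and the denominator is at
-- least 1. Powers of two turn the final estimates into comparisons of exponents.
bounded-by-power : ∀ q → ∃[ a ] (q ℚ.≤ frac (2 ^ a) 1)
bounded-by-power (mkℚ (+ p) d c) = p ,
  ≐-≤ (mkℚ-≐ p d c) (frac-≐ (2 ^ p) 0)
    (*-mono-≤ (<⇒≤ (n<2^n p)) (s≤s z≤n))
bounded-by-power q@(mkℚ -[1+ p ] d c) = 0 ,
  ℚ.≤-trans (ℚ.<⇒≤ (ℚ.negative⁻¹ q)) (frac-nonNeg 1 1)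

-- For denominator `suc d` the exponent `d` works, as `suc d ≤ 2 ^ d` and the numerator is at least
-- 1.
power-below : ∀ {q} → 0ℚ ℚ.< q → ∃[ c ] (frac 1 (2 ^ c) {{m^n≢0 2 c}} ℚ.≤ q)
power-below {mkℚ (+ zero) d c} (ℚ.*<* (ℤ.+<+ ()))
power-below {mkℚ (+ suc p) d c} 0<q = d , helper (2 ^ d) {{m^n≢0 2 d}} (n<2^n d)
  where
  helper : ∀ x .{{_ : ℕ.NonZero x}} → d < x → frac 1 x ℚ.≤ mkℚ (+ suc p) d c
  helper (suc x) d<x = ≐-≤ (frac-≐ 1 x) (mkℚ-≐ (suc p) d c)
    (≤-trans (≤-reflexive (*-identityˡ (suc d))) (≤-trans d<x (m≤m+n (suc x) (p * suc x))))
power-below {mkℚ -[1+ p ] d c} (ℚ.*<* ())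

-- With D = `suc d` the two numbers are (m+1)D - 1 and D². A divisor of the first is coprime to D;
-- if it also divides D², it divides D and is therefore 1.
coprime-pred : ∀ m d → Coprime (d + m * suc d) (d + d * suc d + 1)
coprime-pred m d {i} (i∣x , i∣DD) = c (i∣x , coprime-divisor {i} {suc d} {suc d} c′ (subst (i ∣_) eq i∣DD))
  where
  c : Coprime (d + m * suc d) (suc d)
  c {j} (j∣x , j∣D) = ∣1⇒≡1 (∣m+n∣m⇒∣n {j} {d + m * suc d} {1}
    (subst (j ∣_) (+-comm 1 (d + m * suc d)) (∣-trans j∣D (n∣m*n (suc m)))) j∣x)
  c′ : Coprime i (suc d)
  c′ (j∣i , j∣D) = c (∣-trans j∣i i∣x , j∣D)
  eq : d + d * suc d + 1 ≡ suc d * suc d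
  eq = +-comm (d + d * suc d) 1

-- m/d − 1/d², which is in lowest terms as md − 1 is coprime to d.
approx : (m d : ℕ) → .{{ℕ.NonZero d}} → ℚ
approx zero    d       = 0ℚ
approx (suc m) (suc d) = mkℚ (+ (d + m * suc d)) (d + d * suc d)
  (subst (Coprime _) (+-comm (d + d * suc d) 1) (coprime-pred m d))

approx-≐ : ∀ m d → approx (suc m) (suc d) ≐ mkℚᵘ (+ (d + m * suc d)) (d + d * suc d)
approx-≐ m d = ℚᵘ.≃-refl

-- The code is obtained by arithmetic alone, without any gcd. The factor `sg m` covers `m = 0`,
-- where the value is `0ℚ` with denominator 1.
code-approx : ∀ m d .{{_ : ℕ.NonZero d}} →
  pair (2 * (m * d ∸ 1)) (sg m * (d * d ∸ 1)) ≡ code (approx m d)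
code-approx zero    d       = refl
code-approx (suc m) (suc d) = cong (pair (2 * (d + m * suc d))) (+-identityʳ (d + d * suc d))

approx-nonNeg : ∀ m d .{{_ : ℕ.NonZero d}} → 0ℚ ℚ.≤ approx m d
approx-nonNeg zero    d       = ℚ.≤-refl
approx-nonNeg (suc m) (suc d) = ℚ.nonNegative⁻¹ (approx (suc m) (suc d))

approx-≤ : ∀ m d .{{_ : ℕ.NonZero d}} → approx m d ℚ.≤ frac m d
approx-≤ zero    d       = frac-nonNeg 0 d
approx-≤ (suc m) (suc d) = ≐-≤ (approx-≐ m d) (frac-≐ (suc m) d)
  (≤-trans (*-monoˡ-≤ (suc d) (n≤1+n (d + m * suc d))) (≤-reflexive (*-assoc (suc m) (suc d) (suc d))))

-- The fraction does not decrease, and `d ≤ e` makes the subtracted 1/e² at most 1/d².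
approx-mono : ∀ {m d n e} .{{_ : ℕ.NonZero d}} .{{_ : ℕ.NonZero e}} →
  m * e ≤ n * d → d ≤ e → approx m d ℚ.≤ approx n e
approx-mono {zero}  {d}     {n}     {e}     _ _ = approx-nonNeg n e
approx-mono {suc m} {suc d} {suc n} {suc e} me≤nd d≤e =
  ≐-≤ (approx-≐ m d) (approx-≐ n e) (begin
    (M * D ∸ 1) * (E * E)            ≡⟨ *-distribʳ-∸ (E * E) (M * D) 1 ⟩
    M * D * (E * E) ∸ 1 * (E * E)    ≡⟨ cong (_∸ 1 * (E * E)) (l₁ M D E) ⟩
    M * E * (D * E) ∸ 1 * (E * E)    ≤⟨ ∸-mono (*-monoˡ-≤ (D * E) me≤nd) (*-monoʳ-≤ 1 (*-mono-≤ d≤e d≤e)) ⟩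
    N * D * (D * E) ∸ 1 * (D * D)    ≡⟨ cong (_∸ 1 * (D * D)) (l₂ N D E) ⟩
    N * E * (D * D) ∸ 1 * (D * D)    ≡⟨ sym (*-distribʳ-∸ (D * D) (N * E) 1) ⟩
    (N * E ∸ 1) * (D * D)            ∎)
  where
  open ≤-Reasoning
  M = suc m ; N = suc n ; D = suc d ; E = suc e
  l₁ : ∀ x y z → x * y * (z * z) ≡ x * z * (y * z)
  l₁ = ℕ.solve-∀
  l₂ : ∀ x y z → x * y * (y * z) ≡ x * z * (y * y)
  l₂ = ℕ.solve-∀

-- If q = a/b < m/d, then m/d − q ≥ 1/(bd), which exceeds 1/e² as soon as e > bd.
approx-limit : ∀ {q m d} .{{_ : ℕ.NonZero d}} → q ℚ.< frac m d →
  ∃[ B ] (∀ {n e} .{{_ : ℕ.NonZero e}} → B < e → m * e ≤ n * d → q ℚ.< approx n e)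
approx-limit {q@(mkℚ -[1+ a ] b c)} {m} {d} _ =
  0 , λ {n} {e} _ _ → ℚ.<-≤-trans (ℚ.negative⁻¹ q) (approx-nonNeg n e)
approx-limit {mkℚ (+ a) b c} {m} {suc d} q<m/d = suc b * suc d , λ {n} {e} → limit {n} {e}
  where
  B = suc b ; D = suc d
  aD<mB : a * D < m * B
  aD<mB = ≐-<⁻¹ (mkℚ-≐ a b c) (frac-≐ m d) q<m/d
  limit : ∀ {n e} .{{_ : ℕ.NonZero e}} → B * D < e → m * e ≤ n * D → mkℚ (+ a) b c ℚ.< approx n e
  limit {zero} {e} _ me≤0 =
    contradiction (subst (λ z → a * D < z * B) (m*n≡0⇒m≡0 m e (n≤0⇒n≡0 me≤0)) aD<mB) λ ()
  limit {n@(suc n′)} {e@(suc e′)} BD<e me≤nD =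
    ≐-< (mkℚ-≐ a b c) (approx-≐ n′ e′)
      (*-cancelʳ-< D (a * (e * e)) ((n * e ∸ 1) * B) (+-cancelʳ-< (B * D) _ _ (begin-strict
        a * (e * e) * D + B * D                ≡⟨ cong (_+ B * D) (l₁ a e D) ⟩
        a * D * (e * e) + B * D                <⟨ +-monoʳ-< (a * D * (e * e)) (≤-trans BD<e (m≤m*n e e)) ⟩
        a * D * (e * e) + e * e                ≡⟨ +-comm (a * D * (e * e)) (e * e) ⟩
        suc (a * D) * (e * e)                  ≤⟨ *-monoˡ-≤ (e * e) aD<mB ⟩
        m * B * (e * e)                        ≡⟨ l₂ m B e ⟩
        m * e * (B * e)                        ≤⟨ *-monoˡ-≤ (B * e) me≤nD ⟩
        n * D * (B * e)                        ≡⟨ l₃ n D B e ⟩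
        n * e * (B * D)                        ≡⟨⟩
        suc (n * e ∸ 1) * (B * D)              ≡⟨ l₄ (n * e ∸ 1) B D ⟩
        (n * e ∸ 1) * B * D + B * D            ∎)))
    where
    open ≤-Reasoning
    l₁ : ∀ x y z → x * (y * y) * z ≡ x * z * (y * y)
    l₁ = ℕ.solve-∀
    l₂ : ∀ x y z → x * y * (z * z) ≡ x * z * (y * z)
    l₂ = ℕ.solve-∀
    l₃ : ∀ x y z w → x * y * (z * w) ≡ x * w * (z * y)
    l₃ = ℕ.solve-∀
    l₄ : ∀ x y z → suc x * (y * z) ≡ x * y * z + y * z
    l₄ = ℕ.solve-∀

-- Dyadic weights

-- Horner's scheme: `weight χ t / 8 ^ t` is the sum over s < t of 8^-(s+1) times the sum of `χ j`
-- over j < 4^s.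
weight : (ℕ → ℕ) → ℕ → ℕ
weight χ = natrec 0 (λ t y → 8 * y + sumTo (4 ^ t) χ)

sumTo-mono : ∀ m {f g} → (∀ {j} → j < m → f j ≤ g j) → sumTo m f ≤ sumTo m g
sumTo-mono zero    f≤g = z≤n
sumTo-mono (suc m) f≤g = +-mono-≤ (sumTo-mono m (f≤g ∘ m<n⇒m<1+n)) (f≤g (n<1+n m))

sumTo-+ : ∀ m f g → sumTo m (λ j → f j + g j) ≡ sumTo m f + sumTo m g
sumTo-+ zero    f g = refl
sumTo-+ (suc m) f g = trans (cong (_+ (f m + g m)) (sumTo-+ m f g))
  (eq (sumTo m f) (sumTo m g) (f m) (g m))
  where
  eq : ∀ a b c d → (a + b) + (c + d) ≡ (a + c) + (b + d)
  eq = ℕ.solve-∀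

sumTo-const : ∀ m c → sumTo m (λ _ → c) ≡ m * c
sumTo-const zero    c = refl
sumTo-const (suc m) c = trans (cong (_+ c) (sumTo-const m c)) (+-comm (m * c) c)

weight-mono : ∀ t {f g} → (∀ {j} → j < 4 ^ t → f j ≤ g j) → weight f t ≤ weight g t
weight-mono zero    f≤g = z≤n
weight-mono (suc t) f≤g = +-mono-≤ (*-monoʳ-≤ 8 (weight-mono t f≤g′)) (sumTo-mono (4 ^ t) f≤g′)
  where
  f≤g′ : ∀ {j} → j < 4 ^ t → _
  f≤g′ j< = f≤g (≤-trans j< (^-monoʳ-≤ 4 (n≤1+n t)))

weight-cong : ∀ t {f g} → (∀ j → f j ≡ g j) → weight f t ≡ weight g t
weight-cong t eq = ≤-antisym (weight-mono t (λ {j} _ → ≤-reflexive (eq j)))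
                             (weight-mono t (λ {j} _ → ≤-reflexive (sym (eq j))))

weight-+ : ∀ t f g → weight (λ j → f j + g j) t ≡ weight f t + weight g t
weight-+ zero    f g = refl
weight-+ (suc t) f g = begin
  8 * weight (λ j → f j + g j) t + sumTo (4 ^ t) (λ j → f j + g j)
    ≡⟨ cong₂ (λ x y → 8 * x + y) (weight-+ t f g) (sumTo-+ (4 ^ t) f g) ⟩
  8 * (weight f t + weight g t) + (sumTo (4 ^ t) f + sumTo (4 ^ t) g)
    ≡⟨ eq (weight f t) (weight g t) (sumTo (4 ^ t) f) (sumTo (4 ^ t) g) ⟩
  weight f (suc t) + weight g (suc t) ∎
  where
  open ≡-Reasoning
  eq : ∀ a b c d → 8 * (a + b) + (c + d) ≡ 8 * a + c + (8 * b + d)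
  eq = ℕ.solve-∀

weight-0 : ∀ t → weight (λ _ → 0) t ≡ 0
weight-0 zero    = refl
weight-0 (suc t) = cong₂ (λ x y → 8 * x + y) (weight-0 t) (trans (sumTo-const (4 ^ t) 0) (*-zeroʳ (4 ^ t)))

weight-sum : ∀ {I : Set} t (f : I → ℕ → ℕ) is →
  weight (λ j → sumℕ (map (λ i → f i j) is)) t ≡ sumℕ (map (λ i → weight (f i) t) is)
weight-sum t f []       = weight-0 t
weight-sum t f (i ∷ is) = trans (weight-+ t (f i) _) (cong (λ x → weight (f i) t + x) (weight-sum t f is))

weight-block : ∀ t χ → sumTo (4 ^ t) χ ≤ weight χ (suc t)
weight-block t χ = m≤n+m (sumTo (4 ^ t) χ) (8 * weight χ t)

weight-increasing : ∀ χ {s t} → s ≤ t → weight χ s * 8 ^ t ≤ weight χ t * 8 ^ s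
weight-increasing χ {s} s≤t = go (≤⇒≤′ s≤t)
  where
  go : ∀ {t} → s ℕ.≤′ t → weight χ s * 8 ^ t ≤ weight χ t * 8 ^ s
  go ℕ.≤′-refl = ≤-refl
  go (ℕ.≤′-step {t} s≤t) = begin
    weight χ s * (8 * 8 ^ t)     ≡⟨ eq (weight χ s) (8 ^ t) ⟩
    8 * (weight χ s * 8 ^ t)     ≤⟨ *-monoʳ-≤ 8 (go s≤t) ⟩
    8 * (weight χ t * 8 ^ s)     ≡⟨ sym (*-assoc 8 (weight χ t) (8 ^ s)) ⟩
    8 * weight χ t * 8 ^ s       ≤⟨ *-monoˡ-≤ (8 ^ s) (m≤m+n (8 * weight χ t) _) ⟩
    weight χ (suc t) * 8 ^ s     ∎
    where
    open ≤-Reasoning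
    eq : ∀ x y → x * (8 * y) ≡ 8 * (x * y)
    eq = ℕ.solve-∀

weight-vanishes : ∀ {χ} t → (∀ {j} → j < 4 ^ t → χ j ≡ 0) → weight χ t ≡ 0
weight-vanishes t χ≡0 = n≤0⇒n≡0 (≤-trans
  (weight-mono t {g = λ _ → 0} (≤-reflexive ∘ χ≡0)) (≤-reflexive (weight-0 t)))

2^n*4^n≡8^n : ∀ n → 2 ^ n * 4 ^ n ≡ 8 ^ n
2^n*4^n≡8^n zero    = refl
2^n*4^n≡8^n (suc n) = trans (eq (2 ^ n) (4 ^ n)) (cong (8 *_) (2^n*4^n≡8^n n))
  where
  eq : ∀ x y → 2 * x * (4 * y) ≡ 8 * (x * y)
  eq = ℕ.solve-∀

-- The blocks from `T` on have total mass at most the sum of 4^s / 8^(s+1) over s ≥ T, which is 2^-T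
-- / 4. The factor 4 is given away.
weight-tail : ∀ {χ T t} → (∀ j → χ j ≤ 1) → weight χ T ≡ 0 → T ≤ t →
  weight χ t * 2 ^ T ≤ 1 * 8 ^ t
weight-tail {χ} {T} {t} χ≤1 vanishes T≤t = begin
  weight χ t * 2 ^ T                  ≡⟨ *-comm (weight χ t) (2 ^ T) ⟩
  2 ^ T * weight χ t                  ≤⟨ *-monoʳ-≤ (2 ^ T) (≤-trans (m≤n*m (weight χ t) 4) (m≤m+n _ (4 ^ t))) ⟩
  2 ^ T * (4 * weight χ t + 4 ^ t)    ≤⟨ tail (≤⇒≤′ T≤t) ⟩
  8 ^ t                               ≡⟨ sym (*-identityˡ (8 ^ t)) ⟩
  1 * 8 ^ t                           ∎
  where
  open ≤-Reasoning
  eq : ∀ x y z → x * (4 * (8 * y + z) + 4 * z) ≡ 8 * (x * (4 * y + z))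
  eq = ℕ.solve-∀
  block≤ : ∀ t → sumTo (4 ^ t) χ ≤ 4 ^ t
  block≤ t = ≤-trans (sumTo-mono (4 ^ t) (λ {j} _ → χ≤1 j))
                     (≤-reflexive (trans (sumTo-const (4 ^ t) 1) (*-identityʳ (4 ^ t))))
  -- The summand 4 ^ t makes the claim inductive.
  tail : ∀ {t} → T ℕ.≤′ t → 2 ^ T * (4 * weight χ t + 4 ^ t) ≤ 8 ^ t
  tail ℕ.≤′-refl =
    ≤-reflexive (trans (cong (λ w → 2 ^ T * (4 * w + 4 ^ T)) vanishes) (2^n*4^n≡8^n T))
  tail (ℕ.≤′-step {t} T≤t) = begin
    2 ^ T * (4 * (8 * weight χ t + sumTo (4 ^ t) χ) + 4 ^ suc t)
      ≤⟨ *-monoʳ-≤ (2 ^ T) (+-monoˡ-≤ (4 ^ suc t) (*-monoʳ-≤ 4 (+-monoʳ-≤ (8 * weight χ t) (block≤ t)))) ⟩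
    2 ^ T * (4 * (8 * weight χ t + 4 ^ t) + 4 ^ suc t)
      ≡⟨ eq (2 ^ T) (weight χ t) (4 ^ t) ⟩
    8 * (2 ^ T * (4 * weight χ t + 4 ^ t))
      ≤⟨ *-monoʳ-≤ 8 (tail T≤t) ⟩
    8 ^ suc t ∎

-- Points and their codes

-- The points are the natural numbers on the first coordinate axis: with denominator 1 their codes
-- are simple arithmetic in `j`.
point : ∀ {n} → ℕ → ℚ^ (suc n)
point j = mkℚ (+ j) 0 (λ (_ , d∣1) → ∣1⇒≡1 d∣1) ∷ replicate _ 0ℚ

point-injective : ∀ {n i j} → point {n} i ≡ point j → i ≡ j
point-injective eq = cong (λ p → ℤ.∣ ℚ.numerator (Vec.head p) ∣) eq

ratℝ-injective : ∀ x y → ratℝ x ≈ℝ ratℝ y → x ≡ y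
ratℝ-injective x y (L⇔ , _) with ℚ.<-cmp x y
... | tri< x<y _ _ = contradiction (Equivalence.from (L⇔ x) x<y) (ℚ.<-irrefl refl)
... | tri≈ _ x≡y _ = x≡y
... | tri> _ _ y<x = contradiction (Equivalence.to (L⇔ y) y<x) (ℚ.<-irrefl refl)

rat-injective : ∀ {n} (p q : ℚ^ n) → rat p ≈ⁿ rat q → p ≡ q
rat-injective []      []      _   = refl
rat-injective (x ∷ p) (y ∷ q) p≈q =
  cong₂ _∷_ (ratℝ-injective x y (p≈q Fin.zero)) (rat-injective p q (p≈q ∘ Fin.suc))

≈ⁿ-refl : ∀ {n} (x : ℝ^ n) → x ≈ⁿ x
≈ⁿ-refl x i = (λ _ → mk⇔ id id) , (λ _ → mk⇔ id id)

∈-finite⁺ : ∀ {n} {q : ℚ^ n} {A} → q ∈ᴸ A → rat q ∈ finite A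
∈-finite⁺ {q = q} = Any.map λ where refl → ≈ⁿ-refl (rat q)

∈-finite⁻ : ∀ {n} {q : ℚ^ n} {A} → rat q ∈ finite A → q ∈ᴸ A
∈-finite⁻ {q = q} = Any.map λ {p} p≈q → sym (rat-injective p q p≈q)

pair-injective : ∀ {a b c d} → pair a b ≡ pair c d → a ≡ c × b ≡ d
pair-injective {a} {b} {c} {d} eq =
    trans (sym (fst-pair a b)) (trans (cong fst eq) (fst-pair c d))
  , trans (sym (snd-pair a b)) (trans (cong snd eq) (snd-pair c d))

codeℤ-injective : ∀ i j → codeℤ i ≡ codeℤ j → i ≡ j
codeℤ-injective (+ m)    (+ n)    eq = cong +_ (*-cancelˡ-≡ m n 2 eq)
codeℤ-injective (+ m)    -[1+ n ] eq = contradiction eq (even≢odd m n)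
codeℤ-injective -[1+ m ] (+ n)    eq = contradiction (sym eq) (even≢odd n m)
codeℤ-injective -[1+ m ] -[1+ n ] eq = cong -[1+_] (*-cancelˡ-≡ m n 2 (suc-injective eq))

codeℚ-injective : ∀ (p q : ℚ) → code p ≡ code q → p ≡ q
codeℚ-injective (mkℚ m d _) (mkℚ n e _) eq with pair-injective {codeℤ m} {d} {codeℤ n} {e} eq
... | m≡n , refl with codeℤ-injective m n m≡n
... | refl = refl

code-injective : ∀ {n} (p q : ℚ^ n) → code p ≡ code q → p ≡ q
code-injective []      []      _  = refl
code-injective (x ∷ p) (y ∷ q) eq with pair-injective {code x} {code p} {code y} {code q} eq
... | x≡y , p≡q = cong₂ _∷_ (codeℚ-injective x y x≡y) (code-injective p q p≡q)

equal-refl : ∀ x → equal x x ≡ 1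
equal-refl x rewrite n∸n≡0 x = refl

equal-≢ : ∀ {x y} → x ≢ y → equal x y ≡ 0
equal-≢ {x} {y} x≢y with <-cmp x y
... | tri< x<y _ _ = m≤n⇒m∸n≡0 (≤-trans (m<n⇒0<n∸m x<y) (m≤n+m (y ∸ x) (x ∸ y)))
... | tri≈ _ x≡y _ = contradiction x≡y x≢y
... | tri> _ _ y<x = m≤n⇒m∸n≡0 (≤-trans (m<n⇒0<n∸m y<x) (m≤m+n (x ∸ y) (y ∸ x)))

count-∈ : ∀ {n} {q : ℚ^ n} {A} → q ∈ᴸ A → sg (count (code q) A) ≡ 1
count-∈ {q = q} {_ ∷ A} (here refl) rewrite equal-refl (code q) = refl
count-∈ {q = q} {x ∷ A} (there q∈A) with equal (code x) (code q)
... | zero  = count-∈ q∈A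
... | suc _ = refl

count-∉ : ∀ {n} {q : ℚ^ n} {A} → ¬ (q ∈ᴸ A) → count (code q) A ≡ 0
count-∉ {A = []}            _   = refl
count-∉ {q = q} {A = x ∷ A} q∉A = cong₂ _+_
  (equal-≢ (λ eq → q∉A (here (sym (code-injective x q eq))))) (count-∉ (q∉A ∘ there))

-- Finite sums in [0,∞]

cancelʳ : ∀ x y → x ℚ.- y ℚ.+ y ≡ x
cancelʳ x y = trans (ℚ.+-assoc x (ℚ.- y) y) (trans (cong (x ℚ.+_) (ℚ.+-inverseˡ y)) (ℚ.+-identityʳ x))

<-+⇒-< : ∀ {p} x y → p ℚ.< x ℚ.+ y → p ℚ.- y ℚ.< x
<-+⇒-< {p} x y p<x+y = subst (p ℚ.- y ℚ.<_)
  (trans (ℚ.+-assoc x y (ℚ.- y)) (trans (cong (x ℚ.+_) (ℚ.+-inverseʳ y)) (ℚ.+-identityʳ x)))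
  (ℚ.+-monoˡ-< (ℚ.- y) p<x+y)

-<⇒<-+ : ∀ p {x} y → p ℚ.- y ℚ.< x → p ℚ.< x ℚ.+ y
-<⇒<-+ p {x} y p-y<x = subst (ℚ._< x ℚ.+ y) (cancelʳ p y) (ℚ.+-monoˡ-< y p-y<x)

-- Density is used twice: `a` is chosen between p - y and x, then `b` between p - a and y.
<-+-split : ∀ {p} x y → p ℚ.< x ℚ.+ y → ∃[ a ] ∃[ b ] (a ℚ.< x × b ℚ.< y × p ℚ.< a ℚ.+ b)
<-+-split {p} x y p<x+y =
  let a , p-y<a , a<x = ℚ.<-dense (<-+⇒-< x y p<x+y)
      b , p-a<b , b<y = ℚ.<-dense (<-+⇒-< y a (subst (p ℚ.<_) (ℚ.+-comm a y) (-<⇒<-+ p y p-y<a)))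
  in a , b , a<x , b<y , subst (p ℚ.<_) (ℚ.+-comm b a) (-<⇒<-+ p a p-a<b)

-- Used for the subadditivity of ν, with all weights taken at one stage, and for a list of points of
-- large κ, with every numerator 1.
sum-≥ : ∀ {I : Set} (x : I → [0,∞]) (f : I → ℕ) d .{{_ : ℕ.NonZero d}} {is} →
  All (λ i → ∀ q → q ℚ.< frac (f i) d → Below (x i) q) is →
  ∀ q → q ℚ.< frac (sumℕ (map f is)) d → Below (D.sum (map x is)) q
sum-≥ x f d []               q q< = subst (q ℚ.<_) (frac-0 d) q<
sum-≥ x f d (_∷_ {i} {is} h hs) q q< =
  let S = sumℕ (map f is)
      a , b , a< , b< , q<a+b = <-+-split (frac (f i) d) (frac S d)
        (subst (q ℚ.<_) (sym (frac-+ (f i) S d)) q<)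
  in a , b , h a a< , sum-≥ x f d hs b b< , q<a+b

term≤sum : ∀ {I : Set} (f : I → ℕ) {i is} → i ∈ᴸ is → f i ≤ sumℕ (map f is)
term≤sum f (here refl)          = m≤m+n _ _
term≤sum f {is = j ∷ _} (there i∈) = ≤-trans (term≤sum f i∈) (m≤n+m _ (f j))

-- Indicators of arbitrary propositions

module Indicator (em : ExcludedMiddle 0ℓ) where

  indicator : Set → ℕ
  indicator P with em {P}
  ... | yes _ = 1
  ... | no  _ = 0

  indicator-≤1 : ∀ P → indicator P ≤ 1
  indicator-≤1 P with em {P}
  ... | yes _ = ≤-refl
  ... | no  _ = z≤n

  indicator-yes : ∀ {P} → P → indicator P ≡ 1
  indicator-yes {P} p with em {P}
  ... | yes _ = refl
  ... | no ¬p = contradiction p ¬p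

  indicator-no : ∀ {P} → ¬ P → indicator P ≡ 0
  indicator-no {P} ¬p with em {P}
  ... | yes p = contradiction p ¬p
  ... | no _  = refl

  indicator-mono : ∀ {P Q} → (P → Q) → indicator P ≤ indicator Q
  indicator-mono {P} {Q} P⇒Q with em {P}
  ... | yes p = ≤-reflexive (sym (indicator-yes (P⇒Q p)))
  ... | no _  = z≤n

  -- Converts a count into the duplicate-free list that `∑` asks for. The bound by `M` is carried
  -- along because it shows that the next index is new.
  enumerate : ∀ M (P : ℕ → Set) → ∃[ js ] (Unique js × All (_< M) js × All P js ×
    sumℕ (map (λ _ → 1) js) ≡ sumTo M (indicator ∘ P))
  enumerate zero    P = [] , [] , [] , [] , refl
  enumerate (suc M) P with enumerate M P | em {P M}
  ... | js , u , js<M , Pjs , eq | yes p =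
    M ∷ js , All.map (λ j<M → ≢-sym (<⇒≢ j<M)) js<M ∷ u , n<1+n M ∷ All.map m<n⇒m<1+n js<M , p ∷ Pjs ,
    trans (cong suc eq) (+-comm 1 _)
  ... | js , u , js<M , Pjs , eq | no ¬p =
    js , u , All.map m<n⇒m<1+n js<M , Pjs , trans eq (sym (+-identityʳ _))

-- The measure ν

module CountingMeasure (em : ExcludedMiddle 0ℓ) (n : ℕ) where
  open Indicator em

  χ : 𝒫 (suc n) → ℕ → ℕ
  χ E j = indicator (rat (point j) ∈ E)

  partialSum : 𝒫 (suc n) → ℕ → ℚ
  partialSum E t = frac (weight (χ E) t) (8 ^ t) {{m^n≢0 8 t}}

  partialSum-increasing : ∀ E {s t} → s ≤ t → partialSum E s ℚ.≤ partialSum E t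
  partialSum-increasing E {s} {t} s≤t =
    frac-≤ {{m^n≢0 8 s}} {{m^n≢0 8 t}} (weight-increasing (χ E) s≤t)

  partialSum-mono : ∀ E F t → weight (χ E) t ≤ weight (χ F) t → partialSum E t ℚ.≤ partialSum F t
  partialSum-mono E F t E≤F = frac-≤ {{m^n≢0 8 t}} {{m^n≢0 8 t}} (*-monoˡ-≤ (8 ^ t) E≤F)

  ν[_] : 𝒫 (suc n) → [0,∞]
  ν[ E ] = record
    { Below    = λ q → ∃[ t ] (q ℚ.< partialSum E t)
    ; negative = λ {q} q<0 → 0 , subst (q ℚ.<_) (sym (frac-0 1)) q<0
    ; downward = λ p<q (t , q<) → t , ℚ.<-trans p<q q<
    ; rounded  = λ (t , q<) → let r , q<r , r< = ℚ.<-dense q< in r , q<r , t , r<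
    }

  vanishing : ∀ E → (∀ j → ¬ (rat (point j) ∈ E)) → ν[ E ] D.≈ 0∞
  vanishing E none =
      (λ q (t , q<) → subst (q ℚ.<_) (trans
        (cong (λ w → frac w (8 ^ t) {{m^n≢0 8 t}}) (weight-vanishes t λ {j} _ → indicator-no (none j)))
        (frac-0 (8 ^ t) {{m^n≢0 8 t}})) q<)
    , (λ q → negative ν[ E ])

  -- Reduces countable to finite subadditivity: a stage of ν inspects finitely many points, and each
  -- covered one needs a single `E i`.
  boundedIndex : ∀ (E : ℕ → 𝒫 (suc n)) M →
    ∃[ I ] (∀ {j} → j < M → rat (point j) ∈ ⋃ E → ∃[ i ] (i < I × rat (point j) ∈ E i))
  boundedIndex E zero    = 0 , λ ()
  boundedIndex E (suc M) with boundedIndex E M | em {rat (point M) ∈ ⋃ E}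
  ... | I , bound | no none = I , λ j<1+M h → case-≤ j<1+M h
    where
    case-≤ : ∀ {j} → j < suc M → rat (point j) ∈ ⋃ E → ∃[ i ] (i < I × rat (point j) ∈ E i)
    case-≤ j<1+M h with m≤n⇒m<n∨m≡n (≤-pred j<1+M)
    ... | inj₁ j<M  = bound j<M h
    ... | inj₂ refl = contradiction h none
  ... | I , bound | yes (i , pM∈Eᵢ) = I ⊔ suc i , case-≤
    where
    case-≤ : ∀ {j} → j < suc M → rat (point j) ∈ ⋃ E → ∃[ i′ ] (i′ < I ⊔ suc i × rat (point j) ∈ E i′)
    case-≤ j<1+M h with m≤n⇒m<n∨m≡n (≤-pred j<1+M)
    ... | inj₁ j<M  = let i′ , i′<I , p = bound j<M h in i′ , ≤-trans i′<I (m≤m⊔n I (suc i)) , p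
    ... | inj₂ refl = i , m≤n⊔m I (suc i) , pM∈Eᵢ

  χ-⋃ : ∀ E M → ∃[ I ] (∀ {j} → j < M → χ (⋃ E) j ≤ sumℕ (map (λ i → χ (E i) j) (upTo I)))
  χ-⋃ E M with boundedIndex E M
  ... | I , bound = I , χ≤
    where
    χ≤ : ∀ {j} → j < M → χ (⋃ E) j ≤ sumℕ (map (λ i → χ (E i) j) (upTo I))
    χ≤ {j} j<M with em {rat (point j) ∈ ⋃ E}
    ... | no _  = z≤n
    ... | yes h = let i , i<I , p = bound j<M h in
      ≤-trans (≤-reflexive (sym (indicator-yes p))) (term≤sum (λ i → χ (E i) j) (∈-upTo⁺ i<I))

  ν : OuterMeasure (suc n)
  ν = record
    { μ           = ν[_]
    ; μ-∅         = vanishing ∅ (λ _ ())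
    ; monotone    = λ E F E⊆F q (t , q<) → t , ℚ.<-≤-trans q<
        (partialSum-mono E F t (weight-mono t (λ _ → indicator-mono (E⊆F _))))
    ; subadditive = λ E q (t , q<) → let I , χ≤ = χ-⋃ E (4 ^ t) in
        inj₂ (I , sum-≥ (λ i → ν[ E i ]) (λ i → weight (χ (E i)) t) (8 ^ t) {{m^n≢0 8 t}} {upTo I}
          (All.tabulate (λ _ _ q< → t , q<)) q
          (ℚ.<-≤-trans q< (frac-≤ {{m^n≢0 8 t}} {{m^n≢0 8 t}} (*-monoˡ-≤ (8 ^ t)
            (≤-trans (weight-mono t χ≤) (≤-reflexive (weight-sum t (λ i → χ (E i)) (upTo I))))))))
    }

  χ-∷ : ∀ q is → ¬ (q ∈ᴸ is) → ∀ j → χ ⟦ q ⟧ j + χ (finite is) j ≤ χ (finite (q ∷ is)) j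
  χ-∷ q is q∉is j with em {rat (point j) ∈ ⟦ q ⟧}
  ... | no _ = indicator-mono there
  ... | yes p≈q = ≤-reflexive (trans
      (cong suc (indicator-no λ p∈is → q∉is (subst (_∈ᴸ is) (p≡q (∈-finite⁻ p≈q)) (∈-finite⁻ p∈is))))
      (sym (indicator-yes (∈-finite⁺ {A = q ∷ is} (here (p≡q (∈-finite⁻ p≈q)))))))
    where
    p≡q : point j ∈ᴸ (q ∷ []) → point j ≡ q
    p≡q (here eq) = eq

  -- On distinct points ν is additive, since no p_j is counted twice. The stages witnessing the two
  -- summands are raised to a common one before adding.
  sum-singletons : ∀ {is} → Unique is → D.sum (map (λ q → ν[ ⟦ q ⟧ ]) is) D.≤ ν[ finite is ]
  sum-singletons []                  r r<0 = negative ν[ finite [] ] r<0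
  sum-singletons {q ∷ is} (q∉is ∷ u) r (a , b , (t₁ , a<) , b<s , r<a+b)
    with sum-singletons u b b<s
  ... | t₂ , b< = t , (begin-strict
      r
        <⟨ r<a+b ⟩
      a ℚ.+ b
        ≤⟨ ℚ.+-mono-≤ (ℚ.<⇒≤ (ℚ.<-≤-trans a< (partialSum-increasing ⟦ q ⟧ (m≤m⊔n t₁ t₂))))
                      (ℚ.<⇒≤ (ℚ.<-≤-trans b< (partialSum-increasing (finite is) (m≤n⊔m t₁ t₂)))) ⟩
      partialSum ⟦ q ⟧ t ℚ.+ partialSum (finite is) t
        ≡⟨ frac-+ (weight (χ ⟦ q ⟧) t) (weight (χ (finite is)) t) (8 ^ t) {{m^n≢0 8 t}} ⟩
      frac (weight (χ ⟦ q ⟧) t + weight (χ (finite is)) t) (8 ^ t) {{m^n≢0 8 t}}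
        ≤⟨ frac-≤ {{m^n≢0 8 t}} {{m^n≢0 8 t}} (*-monoˡ-≤ (8 ^ t) additive) ⟩
      partialSum (finite (q ∷ is)) t ∎)
    where
    open ℚ.≤-Reasoning
    t = t₁ ⊔ t₂
    additive : weight (χ ⟦ q ⟧) t + weight (χ (finite is)) t ≤ weight (χ (finite (q ∷ is))) t
    additive = ≤-trans (≤-reflexive (sym (weight-+ t (χ ⟦ q ⟧) (χ (finite is)))))
      (weight-mono t (λ {j} _ → χ-∷ q is (λ q∈is → All.lookup q∉is q∈is refl) j))

  -- The stage is first raised to `t ⊔ T`, since `weight-tail` speaks of stages from `T` on.
  partialSum-≤ : ∀ E T → weight (χ E) T ≡ 0 → ∀ t → partialSum E t ℚ.≤ frac 1 (2 ^ T) {{m^n≢0 2 T}}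
  partialSum-≤ E T vanishes t = ℚ.≤-trans (partialSum-increasing E (m≤m⊔n t T))
    (frac-≤ {{m^n≢0 8 (t ⊔ T)}} {{m^n≢0 2 T}}
      (weight-tail {T = T} (λ _ → indicator-≤1 _) vanishes (m≤n⊔m t T)))

  stronglyFinite : StronglyFinite ν
  stronglyFinite = vanishing (∁ ℚⁿ) (λ j p∉ → p∉ (point j , ≈ⁿ-refl (rat (point j))))
    -- The bound 1 is the tail estimate 2^-T at T = 0, where the weight is 0 by definition.
    , frac 1 1 , (λ { (inj₁ 1<0) → contradiction 1<0 (≤⇒≯ℚ (frac-nonNeg 1 1))
              ; (inj₂ ((is , u) , 1<)) → let t , 1<s = sum-singletons u (frac 1 1) 1< in
                  ≤⇒≯ℚ (partialSum-≤ (finite is) 0 refl t) 1<s })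
    , tt

  finitelySupported : FinitelySupported ν
  finitelySupported ε ((q , q≮0 , q<ε) , _)
    -- The given `q` may be 0; a larger rational `r` still below `ε` is positive.
    with rounded ε q<ε
  ... | r , q<r , r<ε with power-below (ℚ.≤-<-trans (ℚ.≮⇒≥ q≮0) q<r)
  ... | T , 2^-T≤r = points , r
      , (λ (t , r<) → ≤⇒≯ℚ (ℚ.≤-trans (partialSum-≤ (∁ (finite points)) T vanishes t) 2^-T≤r) r<)
      , r<ε
    where
    -- Stage `T` inspects only indices below `4 ^ T`. Without these points its weight vanishes, and
    -- a tail of at most 2^-T ≤ r remains.
    points = map point (upTo (4 ^ T))
    vanishes : weight (χ (∁ (finite points))) T ≡ 0
    vanishes = weight-vanishes T λ {j} j< → indicator-no λ p∉ →
      p∉ (∈-finite⁺ {q = point j} (∈-map⁺ point (∈-upTo⁺ j<)))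

  approximation : List (ℚ^ (suc n)) → ℕ → ℚ
  approximation A t = approx (weight (χ (finite A)) t) (8 ^ t) {{m^n≢0 8 t}}

  -- Equality of real points reduces to equality of codes, because `rat` and `code` are injective.
  -- This replaces the indicator given by excluded middle by a computable one.
  χ-finite : ∀ A j → sg (occurrences (code (point {n} j)) (code A)) ≡ χ (finite A) j
  χ-finite A j with em {rat (point j) ∈ finite A}
  ... | yes p∈A = trans (cong sg (occurrences-code (code (point {n} j)) A)) (count-∈ (∈-finite⁻ p∈A))
  ... | no p∉A  = trans (cong sg (occurrences-code (code (point {n} j)) A)) (cong sg (count-∉ {A = A} (p∉A ∘ ∈-finite⁺)))

  computable : Computable approximation
  computable = proj₁ program , λ A t →
    subst (proj₁ program ⟨ code A ∷ t ∷ [] ⟩↓_) (correct A t) (proj₂ program (code A ∷ t ∷ []))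
    where
    v₀ : ∀ {k} → Fin (1 + k)
    v₀ = Fin.zero
    v₁ : ∀ {k} → Fin (2 + k)
    v₁ = Fin.suc v₀
    v₃ : ∀ {k} → Fin (4 + k)
    v₃ = Fin.suc (Fin.suc v₁)

    weight-rec : IsRec {2} (λ xs → weight (λ j → sg (occurrences (code (point {n} j)) (lookup xs v₀))) (lookup xs v₁))
    weight-rec = natrec-rec (const-rec 0)
      (+-rec (*-rec (const-rec 8) (var v₁))
             (sumTo-rec (^-rec 4 (var v₀))
               (sg-rec (occurrences-rec
                 -- This is the code of `point j`: `pair (2 * j) 0` codes the rational j/1, and the
                 -- remaining zero coordinates contribute a constant. In the scope j, m, y, A, t the
                 -- variable `v₃` is the code of `A`.
                 (pair-rec (pair-rec (*-rec (const-rec 2) (var v₀)) (const-rec 0))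
                           (const-rec (code (replicate n 0ℚ))))
                 (var v₃)))))
      (var v₁)

    approx-rec : ∀ {W D : Vec ℕ 2 → ℕ} → IsRec W → IsRec D →
      IsRec (λ xs → pair (2 * (W xs * D xs ∸ 1)) (sg (W xs) * (D xs * D xs ∸ 1)))
    approx-rec W D = pair-rec (*-rec (const-rec 2) (∸-rec (*-rec W D) (const-rec 1)))
                              (*-rec (sg-rec W) (∸-rec (*-rec D D) (const-rec 1)))

    program = approx-rec weight-rec (^-rec 8 (var v₁))

    correct : ∀ A t → _ ≡ code (approximation A t)
    correct A t = trans
      (cong (λ w → pair (2 * (w * 8 ^ t ∸ 1)) (sg w * (8 ^ t * 8 ^ t ∸ 1)))
        (weight-cong t (χ-finite A)))
      (code-approx (weight (χ (finite A)) t) (8 ^ t) {{m^n≢0 8 t}})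

  lowerSemicomputable : LowerSemicomputable ν
  lowerSemicomputable = record
    { finitelySupported = finitelySupported
    ; μ̂                 = approximation
    ; μ̂-set             = λ {A} {B} t A∼B → cong (λ w → approx w (8 ^ t) {{m^n≢0 8 t}})
        (weight-cong t λ j → ≤-antisym
          (indicator-mono (∈-finite-mono (point j) (Equivalence.to A∼B)))
          (indicator-mono (∈-finite-mono (point j) (Equivalence.from A∼B))))
    ; μ̂-nonNeg          = λ {A} {t} → ℚ.nonNegative (approx-nonNeg (weight (χ (finite A)) t) (8 ^ t) {{m^n≢0 8 t}})
    ; computable        = computable
    ; increasing        = λ A {s} {t} s≤t → approx-mono
        {weight (χ (finite A)) s} {n = weight (χ (finite A)) t} {{m^n≢0 8 s}} {{m^n≢0 8 t}}
        (weight-increasing (χ (finite A)) s≤t) (^-monoʳ-≤ 8 s≤t)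
    ; bounded           = bounded
    ; converges         = λ A →
          below A
        , λ y (q , ν≯q , q<y) → 0 , λ t _ → q , (λ q<μ̂ → ν≯q (bounded A t q q<μ̂)) , q<y
    }
    where
    ∈-finite-mono : ∀ {A B} (p : ℚ^ (suc n)) → (p ∈ᴸ A → p ∈ᴸ B) → rat p ∈ finite A → rat p ∈ finite B
    ∈-finite-mono p A⊆B p∈A = ∈-finite⁺ (A⊆B (∈-finite⁻ {q = p} p∈A))

    bounded : ∀ A t q → q ℚ.< approximation A t → Below ν[ finite A ] q
    bounded A t q q< = t , ℚ.<-≤-trans q< (approx-≤ (weight (χ (finite A)) t) (8 ^ t) {{m^n≢0 8 t}})

    below : ∀ A y → y D.< ν[ finite A ] →
      ∃[ N ] (∀ t → N ≤ t → ∃[ q ] (¬ Below y q × q ℚ.< approximation A t))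
    below A y (q , y≯q , s , q<) with approx-limit {{m^n≢0 8 s}} q<
    -- From `s` on the partial sums are at least the one above `q`; from `B` on the denominator
    -- satisfies B < 2^B ≤ 8^t, as `approx-limit` demands.
    ... | B , limit = B ⊔ s , λ t N≤t → q , y≯q ,
      limit {weight (χ (finite A)) t} {{m^n≢0 8 t}}
        (≤-trans (n<2^n B) (≤-trans (^-monoˡ-≤ B (s≤s (s≤s z≤n))) (^-monoʳ-≤ 8 (≤-trans (m≤m⊔n B s) N≤t))))
        (weight-increasing (χ (finite A)) (≤-trans (m≤n⊔m B s) N≤t))

-- Attainment of κ at rational points

module _ (em : ExcludedMiddle 0ℓ) (U : TuringMachine) where
  open Kolmogorov em U

  min-attained : ∀ P {k} → min P ≡ [ k ] → P k
  min-attained P eq with em {∃ (IsMinimum P)}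
  min-attained P refl | yes (_ , pk , _) = pk

  min-minimum : ∀ P {k} → IsMinimum P k → min P ≡ [ k ]
  min-minimum P {k} (pk , k≤) with em {∃ (IsMinimum P)}
  ... | yes (j , pj , j≤) = cong [_] (≤-antisym (j≤ k pk) (k≤ j pj))
  ... | no none           = contradiction (k , pk , k≤) none

  K-⟦⟧ : ∀ {n} (q : ℚ^ n) {k} → Kpoint q ≡ [ k ] → K ⟦ q ⟧ ≡ [ k ]
  K-⟦⟧ q eq = min-minimum _
    ( (q , here (≈ⁿ-refl (rat q)) , eq)
    , λ { j (p , here q≈p , eq′) → least p (rat-injective q p q≈p) eq′ })
    where
    least : ∀ {j} p → q ≡ p → Kpoint p ≡ [ j ] → _ ≤ j
    least p refl eq′ with trans (sym eq) eq′
    ... | refl = ≤-refl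

  -- A minimum in ℕ is attained, so a finite `K E` is the complexity of some point of `E`. If `K E`
  -- is infinite, only negative rationals lie below κ(E), which `0 ≤ θ` excludes.
  κ-attained : ∀ {n} (E : 𝒫 n) {θ} → 0ℚ ℚ.≤ θ → Below (2^- K E) θ →
    ∃[ q ] (rat q ∈ E × Below (2^- K ⟦ q ⟧) θ)
  κ-attained E {θ} 0≤θ θ<κ = go (K E) refl θ<κ
    where
    go : ∀ m → K E ≡ m → Below (2^- m) θ → ∃[ q ] (rat q ∈ E × Below (2^- K ⟦ q ⟧) θ)
    go ⊤⁺    _  θ<0 = contradiction θ<0 (≤⇒≯ℚ 0≤θ)
    go [ k ] eq θ<  with min-attained _ eq
    ... | q , q∈E , Kq≡k = q , q∈E , subst (λ m → Below (2^- m) θ) (sym (K-⟦⟧ q Kq≡k)) θ<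

-- Failure of domination for point-attained, summable outer measures

module Domination (em : ExcludedMiddle 0ℓ) (n : ℕ) (κ : OuterMeasure (suc n))
  (κ-attained : ∀ E {θ} → 0ℚ ℚ.≤ θ → Below (μ κ E) θ → ∃[ q ] (rat q ∈ E × Below (μ κ ⟦ q ⟧) θ))
  (κ-summable : ∑ (λ q → μ κ ⟦ q ⟧) D.< ∞)
  where
  open Indicator em
  open CountingMeasure em n

  -- Here the κ(p_j) sum to at most 2^a and β ≥ 2^-c.  Then half = 4^t/2, the
  -- threshold is θ = 2^(a+1)/4^t, and t is so large that β · ν(small) > θ.
  module Witness (a c : ℕ) where
    t = a + c + 7
    Θ = 2 ^ (a + 2 * c + 13)
    half = 2 ^ a * Θ

    half+half : half + half ≡ 4 ^ t
    half+half = begin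
      half + half                             ≡⟨ cong (λ h → half + h) (sym (+-identityʳ half)) ⟩
      2 * half                                ≡⟨ cong (2 *_) (sym (^-distribˡ-+-* 2 a (a + 2 * c + 13))) ⟩
      2 ^ suc (a + (a + 2 * c + 13))          ≡⟨ cong (2 ^_) (eq a c) ⟩
      2 ^ (2 * t)                             ≡⟨ sym (^-*-assoc 2 2 t) ⟩
      4 ^ t                                   ∎
      where
      open ≡-Reasoning
      eq : ∀ a c → suc (a + (a + 2 * c + 13)) ≡ 2 * (a + c + 7)
      eq = ℕ.solve-∀

    8^< : 8 ^ suc t < half * 2 ^ (a + c + 12)
    8^< = begin-strict
      8 ^ suc t                                       ≡⟨ ^-*-assoc 2 3 (suc t) ⟩
      2 ^ (3 * suc t)                                 <⟨ ^-monoʳ-< 2 (s≤s (s≤s z≤n)) (≤-reflexive (eq a c)) ⟩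
      2 ^ (a + (a + 2 * c + 13) + (a + c + 12))       ≡⟨ ^-distribˡ-+-* 2 (a + (a + 2 * c + 13)) (a + c + 12) ⟩
      2 ^ (a + (a + 2 * c + 13)) * 2 ^ (a + c + 12)   ≡⟨ cong (_* 2 ^ (a + c + 12)) (^-distribˡ-+-* 2 a (a + 2 * c + 13)) ⟩
      half * 2 ^ (a + c + 12)                         ∎
      where
      open ≤-Reasoning
      eq : ∀ a c → suc (3 * suc (a + c + 7)) ≡ a + (a + 2 * c + 13) + (a + c + 12)
      eq = ℕ.solve-∀

    <Θ : 2 ^ c * 2 ^ (a + c + 12) < Θ
    <Θ = begin-strict
      2 ^ c * 2 ^ (a + c + 12)   ≡⟨ sym (^-distribˡ-+-* 2 c (a + c + 12)) ⟩
      2 ^ (c + (a + c + 12))     <⟨ ^-monoʳ-< 2 (s≤s (s≤s z≤n)) (≤-reflexive (eq a c)) ⟩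
      Θ                          ∎
      where
      open ≤-Reasoning
      eq : ∀ a c → suc (c + (a + c + 12)) ≡ a + 2 * c + 13
      eq = ℕ.solve-∀

    instance
      Θ≢0 : ℕ.NonZero Θ
      Θ≢0 = m^n≢0 2 (a + 2 * c + 13)

    θ : ℚ
    θ = frac 1 Θ

    Large : ℕ → Set
    Large j = Below (μ κ ⟦ point j ⟧) θ

    -- Markov's inequality: more than `half` distinct points of value above θ would sum to more than
    -- half · θ = 2^a ≥ S.
    fewLarge : ∀ {S} → ¬ Below (∑ λ q → μ κ ⟦ q ⟧) S → S ℚ.≤ frac (2 ^ a) 1 →
      sumTo (4 ^ t) (indicator ∘ Large) ≤ half
    fewLarge {S} S≮∑ S≤2^a with enumerate (4 ^ t) Large
    ... | js , unique , _ , large , length≡ = ≮⇒≥ λ half< → S≮∑ (inj₂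
      ( (map point js , map⁺ point-injective unique)
      , sum-≥ (λ q → μ κ ⟦ q ⟧) (λ _ → 1) Θ
          (All.map⁺ (All.map (λ {j} h q q<θ → downward (μ κ ⟦ point j ⟧) q<θ h) large)) S
          (ℚ.≤-<-trans S≤2^a (frac-< {2 ^ a} {1} (begin-strict
            half                                              <⟨ half< ⟩
            sumTo (4 ^ t) (indicator ∘ Large)                 ≡⟨ sym length≡ ⟩
            sumℕ (map (λ _ → 1) js)                           ≡⟨ cong sumℕ (map-∘ js) ⟩
            sumℕ (map (λ _ → 1) (map point js))               ≡⟨ sym (*-identityʳ _) ⟩
            sumℕ (map (λ _ → 1) (map point js)) * 1           ∎)))))
      where open ≤-Reasoning

    small : 𝒫 (suc n)
    small = record
      { Member = λ x → ∃[ q ] (rat q ≈ⁿ x × ¬ Below (μ κ ⟦ q ⟧) θ)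
      ; resp   = λ {x} {y} x≈y (q , q≈x , h) → q , ≈ⁿ-trans {x = rat q} {x} {y} q≈x x≈y , h
      }

    -- Attainment would produce a single point of `small` whose value exceeds θ, against the
    -- definition of the set.
    κ-small : ¬ Below (μ κ small) θ
    κ-small θ<κ with κ-attained small (frac-nonNeg 1 Θ) θ<κ
    ... | q , (p , p≈q , p-small) , q-large with rat-injective p q p≈q
    ... | refl = p-small q-large

    manySmall : sumTo (4 ^ t) (indicator ∘ Large) ≤ half → half ≤ sumTo (4 ^ t) (χ small)
    manySmall few = +-cancelʳ-≤ half half _ (begin
      half + half                                              ≡⟨ trans half+half (sym (*-identityʳ (4 ^ t))) ⟩
      4 ^ t * 1                                                ≡⟨ sym (sumTo-const (4 ^ t) 1) ⟩
      sumTo (4 ^ t) (λ _ → 1)                                  ≤⟨ sumTo-mono (4 ^ t) (λ {j} _ → covered j) ⟩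
      sumTo (4 ^ t) (λ j → χ small j + indicator (Large j))    ≡⟨ sumTo-+ (4 ^ t) (χ small) (indicator ∘ Large) ⟩
      sumTo (4 ^ t) (χ small) + sumTo (4 ^ t) (indicator ∘ Large)
                                                               ≤⟨ +-monoʳ-≤ (sumTo (4 ^ t) (χ small)) few ⟩
      sumTo (4 ^ t) (χ small) + half                           ∎)
      where
      open ≤-Reasoning
      covered : ∀ j → 1 ≤ χ small j + indicator (Large j)
      covered j with em {Large j}
      ... | yes _ = m≤n+m 1 (χ small j)
      ... | no ¬l = ≤-trans (≤-reflexive (sym (indicator-yes (point j , ≈ⁿ-refl (rat (point j)) , ¬l)))) (m≤m+n _ 0)

    -- Half of the lower bound half / 8^(t+1) = 2^-(a+c+11) for ν(small), which leaves room for
    -- strictness. Then 2^-c · x = 2^-(a+2c+12) is exactly 2θ; the shift 7 in `t` makes this work.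
    x : ℚ
    x = frac 1 (2 ^ (a + c + 12)) {{m^n≢0 2 (a + c + 12)}}

    ν-small : half ≤ sumTo (4 ^ t) (χ small) → Below ν[ small ] x
    ν-small many = suc t , frac-< {{m^n≢0 2 (a + c + 12)}} {{m^n≢0 8 (suc t)}} (begin-strict
      1 * 8 ^ suc t                                  ≡⟨ *-identityˡ (8 ^ suc t) ⟩
      8 ^ suc t                                      <⟨ 8^< ⟩
      half * 2 ^ (a + c + 12)                        ≤⟨ *-monoˡ-≤ (2 ^ (a + c + 12)) (≤-trans many (weight-block t (χ small))) ⟩
      weight (χ small) (suc t) * 2 ^ (a + c + 12)    ∎)
      where open ≤-Reasoning

    θ<bx : ∀ {b} → frac 1 (2 ^ c) {{m^n≢0 2 c}} ℚ.≤ b → θ ℚ.< b ℚ.* x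
    θ<bx {b} 2^-c≤b = begin-strict
      θ
        <⟨ frac-< {1} {Θ} {1} {2 ^ c * 2 ^ (a + c + 12)} {{Θ≢0}} {{nz}} (*-monoʳ-< 1 <Θ) ⟩
      frac 1 (2 ^ c * 2 ^ (a + c + 12)) {{nz}}
        ≡⟨ sym (frac-* 1 1 (2 ^ c) (2 ^ (a + c + 12)) {{m^n≢0 2 c}} {{m^n≢0 2 (a + c + 12)}}) ⟩
      frac 1 (2 ^ c) {{m^n≢0 2 c}} ℚ.* x
        ≤⟨ ℚ.*-monoʳ-≤-nonNeg x {{ℚ.nonNegative (frac-nonNeg 1 _ {{m^n≢0 2 (a + c + 12)}})}} 2^-c≤b ⟩
      b ℚ.* x ∎
      where
      open ℚ.≤-Reasoning
      nz = m*n≢0 (2 ^ c) (2 ^ (a + c + 12)) {{m^n≢0 2 c}} {{m^n≢0 2 (a + c + 12)}}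

  not-dominated : ∀ β → β ∈⟨0,∞⟩ → ¬ (∀ E → β D.* ν[ E ] D.≤ μ κ E)
  not-dominated β ((b₀ , b₀≮0 , b₀<β) , _) dominated =
    let S , S≮∑ , _    = κ-summable
        -- The witness `b₀` of β > 0 is only known to be nonnegative; rounding gives a positive `b`.
        b , b₀<b , b<β = rounded β b₀<β
        0<b            = ℚ.≤-<-trans (ℚ.≮⇒≥ b₀≮0) b₀<b
        a , S≤2^a      = bounded-by-power S
        c , 2^-c≤b     = power-below 0<b
        open Witness a c
    -- As θ < b · x with `b` below β and `x` below ν(small), domination would put θ below κ(small).
    in κ-small (dominated small θ (inj₂
         ( b , x , ℚ.<⇒≤ 0<b , frac-nonNeg 1 (2 ^ (a + c + 12)) {{m^n≢0 2 (a + c + 12)}}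
         , b<β , ν-small (manySmall (fewLarge S≮∑ S≤2^a)) , θ<bx 2^-c≤b)))

lemma4p4 : (em : ExcludedMiddle 0ℓ) →
    (U : TuringMachine) → IsUniversalPrefixMachine U →
    (n : ℕ) → n ≥ 1 →
    ¬ GloballyOptimal (Kolmogorov.κ em U n)
-- The bound S on the sum of κ over points comes from strong finiteness, a part of the global
-- optimality being refuted.
lemma4p4 em U _ (suc n) _ (((_ , summable) , _) , optimal) =
  let β , 0<β<∞ , dominated = optimal ν stronglyFinite lowerSemicomputable
  in Domination.not-dominated em n (Kolmogorov.κ em U (suc n)) (κ-attained em U) summable β 0<β<∞ dominated
  where open CountingMeasure em n
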